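{- Let $s,s'$ be integers with $0<s'<s$ and let $G$ be a (connected, possibly infinite) graph that is $(s,s')^*$-dismantlable. Then $G$ is $\delta$-hyperbolic with $$\delta = 16(s+s')\left\lceil \frac{s+s'}{s-s'}\right\rceil + \frac{1}{2}\ \leq\ 32\,\frac{s(s+s')}{s-s'} + \frac{1}{2}.$$
   Context: All graphs are undirected, connected, without loops or multiple edges, but not necessarily finite; $d=d_G$ is the shortest-path distance. For a vertex $v$ and integer $r\ge 0$, $B_r(v,G)=\{x\in V: d_G(v,x)\le r\}$. Given a well-order $\preceq$ on $V$, put $X_v=\{w\in V: w\preceq v\}$. A graph $G$ is $(s,s')^*$-dismantlable if $V$ admits a well-order $\preceq$ such that for each vertex $v$ (other than the least element) there exists a vertex $u\neq v$ with $u\preceq v$ and $B_s(v,G)\cap X_v\subseteq B_{s'}(u,G)$. A graph is $\delta$-hyperbolic ($\delta\ge 0$ real) if for any four vertices $u,v,x,y$, the two largest of the three sums $d(u,v)+d(x,y)$, $d(u,x)+d(v,y)$, $d(u,y)+d(v,x)$ differ by at most $2\delta$. -}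

module Defs where

open import Data.Nat using (ℕ; zero; suc; _+_; _*_; _∸_; _≤_; _<_; _⊔_; _⊓_)
open import Data.Nat.DivMod using (_/_)
open import Data.Product using (Σ; ∃; _×_)
open import Data.Sum using (_⊎_)
open import Relation.Binary.PropositionalEquality using (_≡_)
open import Relation.Nullary using (¬_)
open import Induction.WellFounded using (WellFounded)

record Graph : Set₁ where
  field
    V     : Set
    _∼_   : V → V → Set
    sym∼  : ∀ {x y} → x ∼ y → y ∼ x
    irr∼  : ∀ {x} → ¬ (x ∼ x)

module _ (G : Graph) where
  open Graph G

  data Walk : V → V → ℕ → Set where
    here : ∀ {x} → Walk x x 0
    step : ∀ {x y z n} → x ∼ y → Walk y z n → Walk x z (suc n)

  Connected : Set
  Connected = ∀ x y → ∃ λ n → Walk x y n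

  Dist : V → V → ℕ → Set
  Dist x y n = Walk x y n × (∀ m → Walk x y m → n ≤ m)

  InBall : ℕ → V → V → Set
  InBall r v x = ∃ λ n → n ≤ r × Walk v x n

  -- (s,s')*-dismantlable: there is a well-order ≼ on V (given by its strict
  -- part _≺_: irreflexive, transitive, total, well-founded) such that every
  -- non-least v has some u ≠ v, u ≼ v (i.e. u ≺ v) with
  -- B_s(v) ∩ X_v ⊆ B_{s'}(u), where X_v = {w : w ≼ v}.
  record WellOrder : Set₁ where
    field
      _≺_    : V → V → Set
      irr    : ∀ {x} → ¬ (x ≺ x)
      trans≺ : ∀ {x y z} → x ≺ y → y ≺ z → x ≺ z
      total  : ∀ x y → x ≺ y ⊎ x ≡ y ⊎ y ≺ x
      wf     : WellFounded _≺_

  _≼⟨_⟩_ : V → WellOrder → V → Set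
  x ≼⟨ O ⟩ y = WellOrder._≺_ O x y ⊎ x ≡ y

  Dismantlable : ℕ → ℕ → Set₁
  Dismantlable s s' = Σ WellOrder λ O →
    ∀ v → (∃ λ w → WellOrder._≺_ O w v) →
    ∃ λ u → ¬ (u ≡ v) × u ≼⟨ O ⟩ v ×
      (∀ x → InBall s v x → x ≼⟨ O ⟩ v → InBall s' u x)

  -- Four-point condition with 2δ = twoδ (a natural number):
  -- for all u v x y, the largest of the three sums exceeds the middle one
  -- by at most twoδ.
  Hyperbolic2 : ℕ → Set
  Hyperbolic2 twoδ = ∀ u v x y duv dxy dux dvy duy dvx →
    Dist u v duv → Dist x y dxy → Dist u x dux → Dist v y dvy →
    Dist u y duy → Dist v x dvx →
    let a = duv + dxy ; b = dux + dvy ; c = duy + dvx in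
    (a ⊔ b ⊔ c) ≤ ((a ⊓ b) ⊔ (b ⊓ c) ⊔ (a ⊓ c)) + twoδ

-- ceiling division ⌈ a / b ⌉ (b > 0; value at b = 0 is irrelevant, set to 0)
⌈_/_⌉ : ℕ → ℕ → ℕ
⌈ a / zero ⌉ = 0
⌈ a / suc k ⌉ = (a + k) / suc k

{-# OPTIONS --safe #-}
module Submission where

-- Write a = s + s′ and d = s − s′.  If v is the ≼-largest vertex of a closed walk, the arc of
-- length 2 s centred at v can be replaced by a detour of length ≤ 2 s′ through the vertex u that
-- dominates v; this shortens the walk by 2 d and takes place in the ball of radius s′ around u.
-- Hence, by Stokes, a 1-form ω that differs from an exact form by at most s′ per edge in each such
-- ball satisfies d |∮ ω| ≤ a s′ n on closed walks of length n: a linear isoperimetric inequality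
-- without discs.
--
-- If the four-point condition fails by g, opposite sides of a geodesic quadrilateral are g/2 apart.
-- Cutting its corners off at width W leaves an octagon made of four side segments, each at distance
-- ≥ W from the next one, and four chords of length ≤ W.  The form f₀ dg₀ + f₂ dg₂ supported in the
-- W-collars of two opposite segments has integral at least W times their length, up to 4 W².  With
-- W = 2 M, M = a ⌈a / d⌉, the isoperimetric inequality bounds the segments, and then g ≤ 28 M.
--
-- Adjacency is undecidable, so distances are not computable; but the conclusion is stable, and the
-- argument takes place under double negation.

open import Defs
open import Data.Nat using (ℕ; zero; suc; _+_; _*_; _∸_; _≤_; _<_; _≤?_; _<?_; >-nonZero; _⊔_; _⊓_; z≤n; s≤s)
open import Data.Nat.Properties
open import Data.Nat.DivMod using (_/_; _%_; m≡m%n+[m/n]*n; m%n<n; m/n*n≤m)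
open import Data.Nat.Induction using (<-rec)
open import Data.Nat.Tactic.RingSolver using (solve-∀)
open import Data.Integer as ℤ using (ℤ; +_; ∣_∣)
import Data.Integer.Properties as ℤ
import Data.Integer.Tactic.RingSolver as ℤ-Solver
open import Data.Empty using (⊥)
open import Data.Product using (Σ; ∃; _×_; _,_; proj₁; proj₂)
open import Data.Sum using (_⊎_; inj₁; inj₂)
open import Function using (case_of_)
open import Relation.Binary.PropositionalEquality
open import Relation.Nullary using (¬_; Dec; yes; no; contradiction)
open import Relation.Nullary.Decidable using (decidable-stable; recompute)

-- Reasoning under double negation.

private
  infixl 1 _>>=_

  _>>=_ : ∀ {a b} {A : Set a} {B : Set b} → ¬ ¬ A → (A → ¬ ¬ B) → ¬ ¬ B
  (m >>= f) k = m λ x → f x k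

  return : ∀ {a} {A : Set a} → A → ¬ ¬ A
  return x k = k x

≤-stable : ∀ {m n} → ¬ ¬ (m ≤ n) → m ≤ n
≤-stable {m} {n} = decidable-stable (m ≤? n)

excluded-middle : (A : Set) → ¬ ¬ (A ⊎ ¬ A)
excluded-middle A k = k (inj₂ λ x → k (inj₁ x))

-- Walks, integrals along them, and their largest vertices.

module Walks (G : Graph) where
  open Graph G

  infixr 5 _++_

  _++_ : ∀ {x y z m n} → Walk G x y m → Walk G y z n → Walk G x z (m + n)
  here     ++ w′ = w′
  step e w ++ w′ = step e (w ++ w′)

  snoc : ∀ {x y z n} → Walk G x y n → y ∼ z → Walk G x z (suc n)
  snoc here       e = step e here
  snoc (step f w) e = step f (snoc w e)

  reverse : ∀ {x y n} → Walk G x y n → Walk G y x n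
  reverse here       = here
  reverse (step e w) = snoc (reverse w) (sym∼ e)

  split : ∀ m {n x z} (w : Walk G x z (m + n)) →
          ∃ λ y → Σ (Walk G x y m) λ w₁ → Σ (Walk G y z n) λ w₂ → w ≡ w₁ ++ w₂
  split zero    w          = _ , here , w , refl
  split (suc m) (step e w) with split m w
  ... | y , w₁ , w₂ , refl = y , step e w₁ , w₂ , refl

  All : (V → Set) → ∀ {x y n} → Walk G x y n → Set
  All P (here {x})       = P x
  All P (step {x} e w) = P x × All P w

  All-head : ∀ {P : V → Set} {x y n} (w : Walk G x y n) → All P w → P x
  All-head here       p       = p
  All-head (step e w) (p , _) = p

  All-last : ∀ {P : V → Set} {x y n} (w : Walk G x y n) → All P w → P y
  All-last here       p        = p
  All-last (step e w) (_ , ps) = All-last w ps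

  All-map : ∀ {P Q : V → Set} → (∀ x → P x → Q x) →
            ∀ {x y n} (w : Walk G x y n) → All P w → All Q w
  All-map f here       p        = f _ p
  All-map f (step e w) (p , ps) = f _ p , All-map f w ps

  All-zip : ∀ {P Q : V → Set} {x y n} (w : Walk G x y n) →
            All P w → All Q w → All (λ z → P z × Q z) w
  All-zip here       p        q        = p , q
  All-zip (step e w) (p , ps) (q , qs) = (p , q) , All-zip w ps qs

  All-++ : ∀ {P : V → Set} {x y z m n} (w : Walk G x y m) (w′ : Walk G y z n) →
           All P w → All P w′ → All P (w ++ w′)
  All-++ here       w′ p        qs = qs
  All-++ (step e w) w′ (p , ps) qs = p , All-++ w w′ ps qs

  All-++⁻ : ∀ {P : V → Set} {x y z m n} (w : Walk G x y m) (w′ : Walk G y z n) →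
            All P (w ++ w′) → All P w × All P w′
  All-++⁻ here       w′ ps       = All-head w′ ps , ps
  All-++⁻ (step e w) w′ (p , ps) with All-++⁻ w w′ ps
  ... | qs , rs = (p , qs) , rs

  All-near-first : ∀ {r v x y k n} → Walk G v x k → (w : Walk G x y n) → k + n ≤ r →
                   All (InBall G r v) w
  All-near-first {k = k} a here k≤r = k , ≤-trans (m≤m+n k 0) k≤r , a
  All-near-first {k = k} a (step {n = n} e w) k≤r =
    (k , ≤-trans (m≤m+n k (suc n)) k≤r , a) ,
    All-near-first (snoc a e) w (≤-trans (≤-reflexive (sym (+-suc k n))) k≤r)

  All-near-last : ∀ {r x y n} (w : Walk G x y n) → n ≤ r → All (InBall G r y) w
  All-near-last here              n≤r = 0 , n≤r , here
  All-near-last w@(step {n = n} e w′) n≤r =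
    (suc n , n≤r , reverse w) , All-near-last w′ (≤-trans (n≤1+n n) n≤r)

  module Integral (ω : V → V → ℤ) where

    ∮ : ∀ {x y n} → Walk G x y n → ℤ
    ∮ here               = + 0
    ∮ (step {x} {y} e w) = ω x y ℤ.+ ∮ w

    ∮-++ : ∀ {x y z m n} (w : Walk G x y m) (w′ : Walk G y z n) →
           ∮ (w ++ w′) ≡ ∮ w ℤ.+ ∮ w′
    ∮-++ here       w′ = sym (ℤ.+-identityˡ _)
    ∮-++ (step e w) w′ = trans (cong (λ i → ω _ _ ℤ.+ i) (∮-++ w w′)) (sym (ℤ.+-assoc (ω _ _) (∮ w) (∮ w′)))

  module Peak (_≼_ : V → V → Set) (total : ∀ x y → x ≼ y ⊎ y ≼ x)
              (≼-refl : ∀ {x} → x ≼ x)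
              (≼-trans : ∀ {x y z} → x ≼ y → y ≼ z → x ≼ z) where

    -- Prepending a vertex either keeps the old peak or, by totality, makes the new vertex the peak.
    -- The splitting is recorded through lengths and integrals, because an equation between walks
    -- would need a transport along `m + k ≡ n`.
    peak : ∀ {x y n} (w : Walk G x y n) →
           ∃ λ v → ∃ λ m → ∃ λ k → Σ (Walk G x v m) λ w₁ → Σ (Walk G v y k) λ w₂ →
           m + k ≡ n × (∀ ω → let open Integral ω in ∮ w ≡ ∮ w₁ ℤ.+ ∮ w₂) ×
           All (_≼ v) w₁ × All (_≼ v) w₂ × All (_≼ v) w
    peak here = _ , 0 , 0 , here , here , refl , (λ ω → refl) , ≼-refl , ≼-refl , ≼-refl
    peak (step {x} {y} e w) with peak w
    ... | v , m , k , w₁ , w₂ , eq , ∮eq , a₁ , a₂ , a with total x v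
    ... | inj₁ x≼v = v , suc m , k , step e w₁ , w₂ , cong suc eq ,
          (λ ω → trans (cong (λ i → ω x y ℤ.+ i) (∮eq ω)) (sym (ℤ.+-assoc (ω x y) _ _))) ,
          (x≼v , a₁) , a₂ , (x≼v , a)
    ... | inj₂ v≼x = x , 0 , _ , here , step e w , refl , (λ ω → sym (ℤ.+-identityˡ _)) ,
          ≼-refl , b , b
      where b = ≼-refl , All-map (λ z z≼v → ≼-trans z≼v v≼x) w a

-- The linear isoperimetric inequality.

∣a+b∣≤ : ∀ {a b m n} → ∣ a ∣ ≤ m → ∣ b ∣ ≤ n → ∣ a ℤ.+ b ∣ ≤ m + n
∣a+b∣≤ {a} {b} p q = ≤-trans (ℤ.∣i+j∣≤∣i∣+∣j∣ a b) (+-mono-≤ p q)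

∣a-b∣≤ : ∀ {a b m n} → ∣ a ∣ ≤ m → ∣ b ∣ ≤ n → ∣ a ℤ.- b ∣ ≤ m + n
∣a-b∣≤ {a} {b} p q = ≤-trans (ℤ.∣i-j∣≤∣i∣+∣j∣ a b) (+-mono-≤ p q)

halves : ∀ n s → n ≤ s + s → ∃ λ p → ∃ λ q → p + q ≡ n × p ≤ s × q ≤ s
halves n s n≤2s with ≤-total n s
... | inj₁ n≤s = n , 0 , +-identityʳ n , n≤s , z≤n
... | inj₂ s≤n = s , n ∸ s , m+[n∸m]≡n s≤n , ≤-refl ,
      ≤-trans (∸-monoˡ-≤ s n≤2s) (≤-reflexive (m+n∸n≡m s s))

-- Dismantlability and closeness are only required up to double negation, and the well-order is
-- replaced by a total preorder: this is what survives in the graph of labelled vertices below.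
module Area
  (G : Graph) (_≼_ : Graph.V G → Graph.V G → Set) (total : ∀ x y → x ≼ y ⊎ y ≼ x)
  (≼-refl : ∀ {x} → x ≼ x) (≼-trans : ∀ {x y z} → x ≼ y → y ≼ z → x ≼ z)
  (s s′ d : ℕ) (s≡s′+d : s ≡ s′ + d) (0<d : 0 < d)
  (dominated : ∀ v w → Graph._∼_ G w v → w ≼ v →
    ¬ ¬ ∃ λ u → ∀ x → InBall G s v x → x ≼ v → ¬ ¬ InBall G s′ u x)
  (ω φ : Graph.V G → Graph.V G → ℤ)
  (nearly-exact : ∀ u {x y} → Graph._∼_ G x y → InBall G s′ u x → ∣ ω x y ℤ.- (φ u y ℤ.- φ u x) ∣ ≤ s′)
  where

  open Graph G
  open Walks G
  open Integral ω
  open Peak _≼_ total ≼-refl ≼-trans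

  Near : V → V → Set
  Near u x = ¬ ¬ InBall G s′ u x

  -- The differences of `φ u` telescope along the walk, so only the error of at most `s′` on each
  -- edge survives.
  ∮-near : ∀ u {x y n} (w : Walk G x y n) → All (Near u) w →
           ∣ ∮ w ℤ.- (φ u y ℤ.- φ u x) ∣ ≤ n * s′
  ∮-near u {x} here _ = ≤-reflexive (cong ∣_∣ (lem (φ u x)))
    where
    lem : ∀ a → + 0 ℤ.- (a ℤ.- a) ≡ + 0
    lem = ℤ-Solver.solve-∀
  ∮-near u {x} {y} (step {y = z} e w) (near , nears) =
    subst (λ i → ∣ i ∣ ≤ _) (lem (ω x z) (∮ w) (φ u x) (φ u y) (φ u z))
      (∣a+b∣≤ {ω x z ℤ.- (φ u z ℤ.- φ u x)}
        (≤-stable (near >>= λ b → return (nearly-exact u e b))) (∮-near u w nears))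
    where
    lem : ∀ a b x y z → (a ℤ.- (z ℤ.- x)) ℤ.+ (b ℤ.- (y ℤ.- z)) ≡ (a ℤ.+ b) ℤ.- (y ℤ.- x)
    lem = ℤ-Solver.solve-∀

  -- Exchanging 2 s edges for at most 2 s′ costs an error of (2 s + 2 s′) s′ and saves 2 d edges.
  -- The slope is the quotient (s + s′) s′ / d, with the denominator cleared.
  Bound : ℕ → Set
  Bound n = ∀ {x} (c : Walk G x x n) → d * ∣ ∮ c ∣ ≤ (s + s′) * s′ * n

  d≤s+s′ : d ≤ s + s′
  d≤s+s′ = ≤-trans (≤-trans (m≤n+m d s′) (≤-reflexive (sym s≡s′+d))) (m≤m+n s s′)

  -- Every vertex of a loop of length at most 2 s at `v` is within `s` of `v`, hence near `u`.
  -- Around a loop the exact part vanishes, and the remaining error n s′ fits the bound because d ≤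
  -- s + s′.
  short-bound : ∀ {v n} → n ≤ s + s → (c : Walk G v v n) → All (_≼ v) c →
                ∀ u → (∀ x → InBall G s v x → x ≼ v → Near u x) →
                d * ∣ ∮ c ∣ ≤ (s + s′) * s′ * n
  short-bound {v} {n} n≤2s c below u near with halves n s n≤2s
  ... | p , q , refl , p≤s , q≤s with split p c
  ... | y , c₁ , c₂ , refl = begin
    d * ∣ ∮ c ∣                ≤⟨ *-mono-≤ d≤s+s′ ∮c≤ ⟩
    (s + s′) * ((p + q) * s′)  ≡⟨ lem (s + s′) (p + q) s′ ⟩
    (s + s′) * s′ * (p + q)    ∎
    where
    open ≤-Reasoning
    lem : ∀ a b c → a * (b * c) ≡ a * c * b
    lem = solve-∀
    lem′ : ∀ a b → a ℤ.- (b ℤ.- b) ≡ a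
    lem′ = ℤ-Solver.solve-∀
    nears : All (Near u) c
    nears = All-map (λ { x (b , x≼v) → near x b x≼v }) c
      (All-zip c (All-++ c₁ c₂ (All-near-first here c₁ p≤s) (All-near-last c₂ q≤s)) below)
    ∮c≤ : ∣ ∮ c ∣ ≤ (p + q) * s′
    ∮c≤ = subst (λ i → ∣ i ∣ ≤ _) (lem′ (∮ c) (φ u v)) (∮-near u c nears)

  -- The arc of length 2 s centred at the peak v is replaced by a detour through u of length ≤ 2 s′.
  long-bound : ∀ {v} r → (∀ {m} → m < s + (r + s) → Bound m) →
               (c : Walk G v v (s + (r + s))) → All (_≼ v) c →
               ∀ u → (∀ x → InBall G s v x → x ≼ v → Near u x) →
               d * ∣ ∮ c ∣ ≤ (s + s′) * s′ * (s + (r + s))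
  long-bound {v} r rec c below u near with split s c
  ... | y , c₁ , c₂₃ , refl with split r c₂₃
  ... | x , c₂ , c₃ , refl = ≤-stable (
    All-last c₁ near₁ >>= λ (l , l≤s′ , w) →
    All-head c₃ near₃ >>= λ (k , k≤s′ , w′) →
    return (conclude l≤s′ w k≤s′ w′))
    where
    near₁ : All (Near u) c₁
    near₁ = All-map (λ { z (b , z≼v) → near z b z≼v }) c₁
      (All-zip c₁ (All-near-first here c₁ ≤-refl) (proj₁ (All-++⁻ c₁ (c₂ ++ c₃) below)))
    near₃ : All (Near u) c₃
    near₃ = All-map (λ { z (b , z≼v) → near z b z≼v }) c₃
      (All-zip c₃ (All-near-last c₃ ≤-refl)
        (proj₂ (All-++⁻ c₂ c₃ (proj₂ (All-++⁻ c₁ (c₂ ++ c₃) below)))))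
    inball⇒near : ∀ {z} → InBall G s′ u z → Near u z
    inball⇒near b = return b

    module _ {l k} (l≤s′ : l ≤ s′) (w : Walk G u y l) (k≤s′ : k ≤ s′) (w′ : Walk G u x k) where
      detour : Walk G x y (k + l)
      detour = reverse w′ ++ w
      old : Walk G x y (s + s)
      old = c₃ ++ c₁
      shorter : Walk G y y (r + (k + l))
      shorter = c₂ ++ detour

      ∮-detour : ∣ ∮ detour ℤ.- (φ u y ℤ.- φ u x) ∣ ≤ (k + l) * s′
      ∮-detour = ∮-near u detour (All-++ (reverse w′) w
        (All-map (λ z → inball⇒near) (reverse w′) (All-near-last (reverse w′) k≤s′))
        (All-map (λ z → inball⇒near) w (All-near-first here w l≤s′)))
      ∮-old : ∣ ∮ old ℤ.- (φ u y ℤ.- φ u x) ∣ ≤ (s + s) * s′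
      ∮-old = ∮-near u old (All-++ c₃ c₁ near₃ near₁)

      -- `old` and `detour` both run from `x` to `y`, so they are compared with the same difference
      -- of `φ u`, which cancels. The base point of the loop moves from `v` to `y`.
      ∮-decompose : ∮ (c₁ ++ c₂ ++ c₃) ≡
        ∮ shorter ℤ.+ ((∮ old ℤ.- (φ u y ℤ.- φ u x)) ℤ.- (∮ detour ℤ.- (φ u y ℤ.- φ u x)))
      ∮-decompose
        rewrite ∮-++ c₁ (c₂ ++ c₃) | ∮-++ c₂ c₃ | ∮-++ c₂ detour | ∮-++ c₃ c₁ =
        lem (∮ c₁) (∮ c₂) (∮ c₃) (∮ detour) (φ u y) (φ u x)
        where
        lem : ∀ a b c e y x → a ℤ.+ (b ℤ.+ c) ≡
              (b ℤ.+ e) ℤ.+ (((c ℤ.+ a) ℤ.- (y ℤ.- x)) ℤ.- (e ℤ.- (y ℤ.- x)))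
        lem = ℤ-Solver.solve-∀

      length-drop : r + (k + l) + (d + d) ≤ s + (r + s)
      length-drop = begin
        r + (k + l) + (d + d)    ≤⟨ +-monoˡ-≤ (d + d) (+-monoʳ-≤ r (+-mono-≤ k≤s′ l≤s′)) ⟩
        r + (s′ + s′) + (d + d)  ≡⟨ lem r s′ d ⟩
        (s′ + d) + (r + (s′ + d))  ≡⟨ cong (λ t → t + (r + t)) (sym s≡s′+d) ⟩
        s + (r + s)              ∎
        where
        open ≤-Reasoning
        lem : ∀ r a b → r + (a + a) + (b + b) ≡ (a + b) + (r + (a + b))
        lem = solve-∀

      length-drop-< : r + (k + l) < s + (r + s)
      length-drop-< = <-≤-trans (m<m+n (r + (k + l)) (<-≤-trans 0<d (m≤m+n d d))) length-drop

      conclude : d * ∣ ∮ (c₁ ++ c₂ ++ c₃) ∣ ≤ (s + s′) * s′ * (s + (r + s))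
      conclude = begin
        d * ∣ ∮ (c₁ ++ c₂ ++ c₃) ∣
          ≡⟨ cong (λ i → d * ∣ i ∣) ∮-decompose ⟩
        d * ∣ ∮ shorter ℤ.+ ((∮ old ℤ.- (φ u y ℤ.- φ u x)) ℤ.- (∮ detour ℤ.- (φ u y ℤ.- φ u x))) ∣
          ≤⟨ *-monoʳ-≤ d (∣a+b∣≤ {∮ shorter} ≤-refl (∣a-b∣≤ {∮ old ℤ.- (φ u y ℤ.- φ u x)} ∮-old ∮-detour)) ⟩
        d * (∣ ∮ shorter ∣ + ((s + s) * s′ + (k + l) * s′))
          ≤⟨ *-monoʳ-≤ d (+-monoʳ-≤ ∣ ∮ shorter ∣ (+-monoʳ-≤ ((s + s) * s′) (*-monoˡ-≤ s′ (+-mono-≤ k≤s′ l≤s′)))) ⟩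
        d * (∣ ∮ shorter ∣ + ((s + s) * s′ + (s′ + s′) * s′))
          ≡⟨ lem d ∣ ∮ shorter ∣ s s′ ⟩
        d * ∣ ∮ shorter ∣ + (s + s′) * s′ * (d + d)
          ≤⟨ +-monoˡ-≤ _ (rec length-drop-< shorter) ⟩
        (s + s′) * s′ * (r + (k + l)) + (s + s′) * s′ * (d + d)
          ≡⟨ sym (*-distribˡ-+ ((s + s′) * s′) _ _) ⟩
        (s + s′) * s′ * (r + (k + l) + (d + d))
          ≤⟨ *-monoʳ-≤ ((s + s′) * s′) length-drop ⟩
        (s + s′) * s′ * (s + (r + s)) ∎
        where
        open ≤-Reasoning
        lem : ∀ d i s t → d * (i + ((s + s) * t + (t + t) * t)) ≡ d * i + (s + t) * t * (d + d)
        lem = solve-∀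

  peaked-bound : ∀ {v n} → (∀ {m} → m < n → Bound m) → (c : Walk G v v n) → All (_≼ v) c →
                 d * ∣ ∮ c ∣ ≤ (s + s′) * s′ * n
  peaked-bound rec here _ = ≤-trans (≤-reflexive (*-zeroʳ d)) z≤n
  peaked-bound {v} {n} rec c@(step {y = y} e w) below = ≤-stable (
    -- The second vertex of the loop is a neighbour of `v` below `v`, which is what domination of
    -- `v` asks for.
    dominated v y (sym∼ e) (All-head w (proj₂ below)) >>= λ (u , near) →
    return (case-length u near (n ≤? s + s)))
    where
    case-length : ∀ u → (∀ x → InBall G s v x → x ≼ v → Near u x) → Dec (n ≤ s + s) →
                  d * ∣ ∮ c ∣ ≤ (s + s′) * s′ * n
    case-length u near (yes n≤2s) = short-bound n≤2s c below u near
    case-length u near (no n≰2s) = go n eq rec c below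
      where
      r = n ∸ (s + s)
      eq : s + (r + s) ≡ n
      eq = trans (lem s r) (m+[n∸m]≡n (<⇒≤ (≰⇒> n≰2s)))
        where
        lem : ∀ s r → s + (r + s) ≡ s + s + r
        lem = solve-∀
      -- The length is generalised so that the equation can be matched by `refl`, which puts the
      -- loop in the form required by `long-bound`.
      go : ∀ n → s + (r + s) ≡ n → (∀ {m} → m < n → Bound m) → (c : Walk G v v n) → All (_≼ v) c →
           d * ∣ ∮ c ∣ ≤ (s + s′) * s′ * n
      go _ refl rec c below = long-bound r rec c below u near

  area : ∀ n → Bound n
  area = <-rec Bound λ n rec c → rotated n rec c
    where
    -- The loop is restarted at its peak; rotation changes neither its length nor its integral.
    rotated : ∀ n → (∀ {m} → m < n → Bound m) → Bound n
    rotated n rec c with peak c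
    ... | v , m , k , w₁ , w₂ , refl , ∮eq , a₁ , a₂ , _ =
      subst₂ (λ i l → d * ∣ i ∣ ≤ (s + s′) * s′ * l)
        (trans (∮-++ w₂ w₁) (trans (ℤ.+-comm (∮ w₂) (∮ w₁)) (sym (∮eq ω)))) (+-comm k m)
        (peaked-bound (λ l → rec (<-≤-trans l (≤-reflexive (+-comm k m)))) (w₂ ++ w₁) (All-++ w₂ w₁ a₂ a₁))

-- Truncated distances to a set.

least : (P : ℕ → Set) (N : ℕ) → ¬ ¬ ∃ λ n → n ≤ N × (n ≡ N ⊎ P n) × (∀ m → P m → n ≤ m)
least P zero    = return (0 , z≤n , inj₁ refl , λ _ _ → z≤n)
least P (suc N) = least P N >>= λ
  { (n , n≤N , inj₂ pn , min) → return (n , m≤n⇒m≤1+n n≤N , inj₂ pn , min)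
  ; (.N , n≤N , inj₁ refl , min) → excluded-middle (P N) >>= λ
    { (inj₁ pN) → return (N , n≤1+n N , inj₂ pN , min)
    ; (inj₂ ¬pN) → return (suc N , ≤-refl , inj₁ refl ,
        λ m pm → ≤∧≢⇒< (min m pm) λ { refl → ¬pN pm }) } }

last : (P : ℕ → Set) → P 0 → ∀ n →
       ¬ ¬ ∃ λ p → p ≤ n × P p × (∀ k → p < k → k ≤ n → ¬ P k)
last P p₀ zero    = return (0 , z≤n , p₀ , λ k 0<k k≤0 _ → <⇒≱ 0<k k≤0)
last P p₀ (suc n) = excluded-middle (P (suc n)) >>= λ
  { (inj₁ pn) → return (suc n , ≤-refl , pn , λ k n<k k≤n _ → <⇒≱ n<k k≤n)
  ; (inj₂ ¬pn) → last P p₀ n >>= λ (p , p≤n , pp , beyond) →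
      return (p , m≤n⇒m≤1+n p≤n , pp , λ k p<k k≤1+n pk →
        case m≤n⇒m<n∨m≡n k≤1+n of λ
          { (inj₁ (s≤s k≤n)) → beyond k p<k k≤n pk
          ; (inj₂ refl) → ¬pn pk }) }

module Truncated (G : Graph) where
  open Graph G
  open Walks G

  -- This is min (N , d (S , x)), expressed through walks because no distance function is at hand.
  IsTruncatedDistance : (V → Set) → ℕ → V → ℕ → Set
  IsTruncatedDistance S N x n =
    n ≤ N × (n ≡ N ⊎ ∃ λ y → S y × Walk G y x n) × (∀ y → S y → ∀ m → Walk G y x m → n ≤ m)

  -- The proof is irrelevant so that the label of a vertex is unique, see `unique`.
  record TruncatedDistance (S : V → Set) (N : ℕ) (x : V) : Set where
    constructor _,_
    field
      value    : ℕ
      .isValue : IsTruncatedDistance S N x value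
  open TruncatedDistance public using (value)

  module _ {S : V → Set} {N : ℕ} where

    -- The cap `N` makes the search finite and is the value when `S` is not reached in fewer than
    -- `N` steps.
    exists : ∀ x → ¬ ¬ TruncatedDistance S N x
    exists x = least (λ n → ∃ λ y → S y × Walk G y x n) N >>= λ (n , n≤N , attained , min) →
      return (n , n≤N , attained , λ y sy m w → min m (y , sy , w))

    value≤N : ∀ {x} (p : TruncatedDistance S N x) → value p ≤ N
    -- The order on ℕ is decidable, so inequalities can be recovered from the irrelevant proof, here
    -- and below.
    value≤N (n , ok) = recompute (n ≤? N) (proj₁ ok)

    value≤walk : ∀ {x} (p : TruncatedDistance S N x) {y m} → S y → Walk G y x m → value p ≤ m
    value≤walk (n , ok) {y} {m} sy w = recompute (n ≤? m) (proj₂ (proj₂ ok) y sy m w)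

    ≤value : ∀ {x} (p : TruncatedDistance S N x) {k} → k ≤ N →
             (∀ y → S y → ∀ m → Walk G y x m → k ≤ m) → k ≤ value p
    ≤value {x} (n , ok) {k} k≤N far = recompute (k ≤? n) (lem ok)
      where
      lem : IsTruncatedDistance S N x n → k ≤ n
      lem (_ , inj₁ refl , _)         = k≤N
      lem (_ , inj₂ (y , sy , w) , _) = far y sy n w

    lipschitz : ∀ {x x′ m} (p : TruncatedDistance S N x) (p′ : TruncatedDistance S N x′) →
                Walk G x x′ m → value p′ ≤ value p + m
    lipschitz {x} {x′} {m} (n , ok) (n′ , ok′) w = recompute (n′ ≤? n + m) (lem ok ok′)
      where
      lem : IsTruncatedDistance S N x n → IsTruncatedDistance S N x′ n′ → n′ ≤ n + m
      lem (_ , inj₁ refl , _) (n′≤N , _) = ≤-trans n′≤N (m≤m+n n m)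
      lem (_ , inj₂ (y , sy , w₀) , _) (_ , _ , min) = min y sy (n + m) (w₀ ++ w)

    unique : ∀ {x} (p p′ : TruncatedDistance S N x) → p ≡ p′
    unique {x} (n , ok) (n′ , ok′) = lem n n′ (≤-antisym (le ok′ ok) (le ok ok′)) ok ok′
      where
      le : ∀ {a b} → .(IsTruncatedDistance S N x a) → .(IsTruncatedDistance S N x b) → b ≤ a
      le {a} {b} q q′ = subst (b ≤_) (+-identityʳ a) (lipschitz (a , q) (b , q′) here)
      lem : ∀ n n′ → n ≡ n′ → .(ok : IsTruncatedDistance S N x n) .(ok′ : IsTruncatedDistance S N x n′) →
            _≡_ {A = TruncatedDistance S N x} (n , ok) (n′ , ok′)
      lem n .n refl ok ok′ = refl

  -- A value below the cap is attained by a walk; the two walks and `w` concatenate to a walk from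
  -- `S` to `T`.
  separated-values : ∀ {S T N D x x′ m} → (∀ y z → S y → T z → ∀ m → Walk G y z m → D ≤ m) →
                     (p : TruncatedDistance S N x) (q : TruncatedDistance T N x′) → Walk G x x′ m →
                     value p < N → value q < N → D ≤ value p + m + value q
  separated-values {S} {T} {N} {D} {x} {x′} {m} sep (a , ok) (b , ok′) w a<N b<N =
    recompute (D ≤? a + m + b) (lem ok ok′)
    where
    lem : IsTruncatedDistance S N x a → IsTruncatedDistance T N x′ b → D ≤ a + m + b
    lem (_ , inj₁ a≡N , _) _ = contradiction a≡N (<⇒≢ a<N)
    lem (_ , inj₂ _ , _) (_ , inj₁ b≡N , _) = contradiction b≡N (<⇒≢ b<N)
    lem (_ , inj₂ (y , sy , v) , _) (_ , inj₂ (z , tz , v′) , _) =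
      sep y z sy tz _ ((v ++ w) ++ reverse v′)

-- Geodesics and their segments.

record Geodesic (G : Graph) : Set where
  open Graph G
  field
    len       : ℕ
    -- With a total function on ℕ, segments are mere shifts of the index; the points beyond `len`
    -- are arbitrary.
    pt        : ℕ → V
    adj       : ∀ i → i < len → pt i ∼ pt (suc i)
    isometric : ∀ {i j m} → i ≤ len → j ≤ len → Walk G (pt i) (pt j) m → j ≤ i + m

open Geodesic

module _ {G : Graph} where
  open Graph G
  open Walks G

  source target : Geodesic G → V
  source A = pt A 0
  target A = pt A (len A)

  On : Geodesic G → V → Set
  On A x = ∃ λ k → k ≤ len A × pt A k ≡ x

  initial : (A : Geodesic G) → ∀ i → i ≤ len A → Walk G (source A) (pt A i) i
  initial A zero    i≤n = here
  initial A (suc i) i<n = snoc (initial A i (<⇒≤ i<n)) (adj A i i<n)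

  final : (A : Geodesic G) → ∀ i k → i + k ≡ len A → Walk G (pt A i) (target A) k
  final A i zero    eq = subst (λ j → Walk G (pt A i) (pt A j) 0) (trans (sym (+-identityʳ i)) eq) here
  final A i (suc k) eq =
    step (adj A i (<-≤-trans (m<m+n i (s≤s z≤n)) (≤-reflexive eq)))
         (final A (suc i) k (trans (sym (+-suc i k)) eq))

  remainder : (A : Geodesic G) → ∀ i → i ≤ len A → Walk G (pt A i) (target A) (len A ∸ i)
  remainder A i i≤n = final A i (len A ∸ i) (m+[n∸m]≡n i≤n)

  module _ (A : Geodesic G) (i j : ℕ) (i≤j : i ≤ j) (j≤n : j ≤ len A) where

    within : ∀ {k} → k ≤ j ∸ i → i + k ≤ len A
    within k≤ = ≤-trans (+-monoʳ-≤ i k≤) (≤-trans (≤-reflexive (m+[n∸m]≡n i≤j)) j≤n)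

    segment : Geodesic G
    segment = record
      { len = j ∸ i
      ; pt = λ k → pt A (i + k)
      ; adj = λ k k< → subst (λ l → pt A (i + k) ∼ pt A l) (sym (+-suc i k))
          (adj A (i + k) (≤-trans (≤-reflexive (sym (+-suc i k))) (within k<)))
      ; isometric = λ {k} {l} {m} k≤ l≤ w →
          +-cancelˡ-≤ i l (k + m) (≤-trans (isometric A (within k≤) (within l≤) w)
            (≤-reflexive (+-assoc i k m)))
      }

    source-segment : source segment ≡ pt A i
    source-segment = cong (pt A) (+-identityʳ i)

    target-segment : target segment ≡ pt A j
    target-segment = cong (pt A) (m+[n∸m]≡n i≤j)

  at : ∀ {x y n} → Walk G x y n → ℕ → V
  at (here {x})           i       = x
  at (step {x} e w) zero    = x
  at (step e w)     (suc i) = at w i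

  at-first : ∀ {x y n} (w : Walk G x y n) → at w 0 ≡ x
  at-first here       = refl
  at-first (step e w) = refl

  at-last : ∀ {x y n} (w : Walk G x y n) → at w n ≡ y
  at-last here       = refl
  at-last (step e w) = at-last w

  at-adj : ∀ {x y n} (w : Walk G x y n) i → i < n → at w i ∼ at w (suc i)
  at-adj (step e w) zero    _         = subst (_ ∼_) (sym (at-first w)) e
  at-adj (step e w) (suc i) (s≤s i<n) = at-adj w i i<n

  at-prefix : ∀ {x y n} (w : Walk G x y n) i → i ≤ n → Walk G x (at w i) i
  at-prefix here       zero    _         = here
  at-prefix (step e w) zero    _         = here
  at-prefix (step e w) (suc i) (s≤s i≤n) = step e (at-prefix w i i≤n)

  at-suffix : ∀ {x y n} (w : Walk G x y n) i → i ≤ n → Walk G (at w i) y (n ∸ i)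
  at-suffix here       zero    _         = here
  at-suffix (step e w) zero    _         = step e w
  at-suffix (step e w) (suc i) (s≤s i≤n) = at-suffix w i i≤n

  -- A shortcut between two points of a shortest walk, completed by its two ends, would give a walk
  -- shorter than `n`.
  geodesic : ∀ {x y n} → Dist G x y n → Σ (Geodesic G) λ A → len A ≡ n × source A ≡ x × target A ≡ y
  geodesic {x} {y} {n} (w , shortest) = record
    { len = n
    ; pt = at w
    ; adj = at-adj w
    ; isometric = λ {i} {j} {m} i≤n j≤n w′ → +-cancelʳ-≤ (n ∸ j) j (i + m) (begin
        j + (n ∸ j)        ≡⟨ m+[n∸m]≡n j≤n ⟩
        n                  ≤⟨ shortest _ ((at-prefix w i i≤n ++ w′) ++ at-suffix w j j≤n) ⟩
        i + m + (n ∸ j)    ∎)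
    } , refl , at-first w , at-last w
    where open ≤-Reasoning

  Far : Geodesic G → Geodesic G → ℕ → Set
  Far A B D = ∀ i j → i ≤ len A → j ≤ len B → ∀ {m} → Walk G (pt A i) (pt B j) m → D ≤ m

  Far-sym : ∀ {A B D} → Far A B D → Far B A D
  Far-sym far i j i≤ j≤ w = far j i j≤ i≤ (reverse w)

-- The 1-form supported in two collars.

∣+m-+n∣≡n∸m : ∀ {m n} → m ≤ n → ∣ + m ℤ.- + n ∣ ≡ n ∸ m
∣+m-+n∣≡n∸m {m} {n} m≤n = trans (cong ∣_∣ (ℤ.[+m]-[+n]≡m⊖n m n)) (ℤ.∣⊖∣-≤ m≤n)

∣+n-+m∣≡n∸m : ∀ {m n} → m ≤ n → ∣ + n ℤ.- + m ∣ ≡ n ∸ m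
∣+n-+m∣≡n∸m {m} {n} m≤n = trans (ℤ.∣i-j∣≡∣j-i∣ (+ n) (+ m)) (∣+m-+n∣≡n∸m m≤n)

∣+m-+n∣≤ : ∀ {m n p} → m ≤ n + p → n ≤ m + p → ∣ + m ℤ.- + n ∣ ≤ p
∣+m-+n∣≤ {m} {n} m≤ n≤ with ≤-total m n
... | inj₁ m≤n = ≤-trans (≤-reflexive (∣+m-+n∣≡n∸m m≤n)) (m≤n+o⇒m∸n≤o n m n≤)
... | inj₂ n≤m = ≤-trans (≤-reflexive (∣+n-+m∣≡n∸m n≤m)) (m≤n+o⇒m∸n≤o m n m≤)

-- a, a′ are the distances, truncated at W, from two points at distance m to one of two sets that
-- are 2 W apart, and b, b′ those to the other set.
∣Δa∣+∣Δb∣≤ : ∀ {W m a a′ b b′} → a ≤ W → a′ ≤ W → b ≤ W → b′ ≤ W →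
  a ≤ a′ + m → a′ ≤ a + m → b ≤ b′ + m → b′ ≤ b + m →
  (a < W → b < W → W + W ≤ a + m + b) → (a′ < W → b′ < W → W + W ≤ a′ + m + b′) →
  (a < W → b′ < W → W + W ≤ a + m + b′) → (a′ < W → b < W → W + W ≤ a′ + m + b) →
  ∣ + a ℤ.- + a′ ∣ + ∣ + b ℤ.- + b′ ∣ ≤ m
∣Δa∣+∣Δb∣≤ {W} {m} {a} {a′} {b} {b′} a≤ a′≤ b≤ b′≤ aa′ a′a bb′ b′b sep sep′ cross cross′ =
  by-order (≤-total a a′) (≤-total b b′)
  where
  -- If a smaller value has reached `W`, its difference vanishes and the other one is at most `m`.
  -- Otherwise a′ + b′ ≤ 2 W ≤ a + m + b. The two smaller values may belong to the same point or to
  -- different ones, whence the four separation hypotheses.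
  ordered : ∀ {a a′ b b′} → a ≤ a′ → b ≤ b′ → a′ ≤ W → b′ ≤ W → a′ ≤ a + m → b′ ≤ b + m →
            (a < W → b < W → W + W ≤ a + m + b) → (a′ ∸ a) + (b′ ∸ b) ≤ m
  ordered {a} {a′} {b} {b′} a≤a′ b≤b′ a′≤ b′≤ a′a b′b sep with a <? W | b <? W
  ... | no a≮W | _ = ≤-trans
    (≤-reflexive (cong (_+ (b′ ∸ b)) (m≤n⇒m∸n≡0 (≤-trans a′≤ (≮⇒≥ a≮W))))) (m≤n+o⇒m∸n≤o b′ b b′b)
  ... | yes _ | no b≮W = ≤-trans
    (≤-reflexive (trans (cong (λ i → (a′ ∸ a) + i) (m≤n⇒m∸n≡0 (≤-trans b′≤ (≮⇒≥ b≮W)))) (+-identityʳ _)))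
    (m≤n+o⇒m∸n≤o a′ a a′a)
  ... | yes a<W | yes b<W = +-cancelˡ-≤ (a + b) _ _ (begin
    a + b + ((a′ ∸ a) + (b′ ∸ b))    ≡⟨ lem a b (a′ ∸ a) (b′ ∸ b) ⟩
    (a + (a′ ∸ a)) + (b + (b′ ∸ b))  ≡⟨ cong₂ _+_ (m+[n∸m]≡n a≤a′) (m+[n∸m]≡n b≤b′) ⟩
    a′ + b′                          ≤⟨ +-mono-≤ a′≤ b′≤ ⟩
    W + W                            ≤⟨ sep a<W b<W ⟩
    a + m + b                        ≡⟨ lem′ a m b ⟩
    a + b + m                        ∎)
    where
    open ≤-Reasoning
    lem : ∀ a b c d → a + b + (c + d) ≡ (a + c) + (b + d)
    lem = solve-∀
    lem′ : ∀ a m b → a + m + b ≡ a + b + m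
    lem′ = solve-∀
  by-order : a ≤ a′ ⊎ a′ ≤ a → b ≤ b′ ⊎ b′ ≤ b → ∣ + a ℤ.- + a′ ∣ + ∣ + b ℤ.- + b′ ∣ ≤ m
  by-order (inj₁ p) (inj₁ q) rewrite ∣+m-+n∣≡n∸m p | ∣+m-+n∣≡n∸m q = ordered p q a′≤ b′≤ a′a b′b sep
  by-order (inj₁ p) (inj₂ q) rewrite ∣+m-+n∣≡n∸m p | ∣+n-+m∣≡n∸m q = ordered p q a′≤ b≤ a′a bb′ cross
  by-order (inj₂ p) (inj₁ q) rewrite ∣+n-+m∣≡n∸m p | ∣+m-+n∣≡n∸m q = ordered p q a≤ b′≤ aa′ b′b cross′
  by-order (inj₂ p) (inj₂ q) rewrite ∣+n-+m∣≡n∸m p | ∣+n-+m∣≡n∸m q = ordered p q a≤ b≤ aa′ bb′ sep′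

∣i*k∣+∣j*l∣≤ : ∀ i k j l → ∣ k ∣ ≤ 1 → ∣ l ∣ ≤ 1 → ∣ (i ℤ.* k) ℤ.+ (j ℤ.* l) ∣ ≤ ∣ i ∣ + ∣ j ∣
∣i*k∣+∣j*l∣≤ i k j l k≤1 l≤1 = ∣a+b∣≤ {i ℤ.* k} (lem i k k≤1) (lem j l l≤1)
  where
  lem : ∀ i k → ∣ k ∣ ≤ 1 → ∣ i ℤ.* k ∣ ≤ ∣ i ∣
  lem i k k≤1 = ≤-trans (≤-reflexive (ℤ.abs-* i k))
    (≤-trans (*-monoʳ-≤ ∣ i ∣ k≤1) (≤-reflexive (*-identityʳ _)))

-- fᵢ = W − min (W , d(· , Aᵢ)), and gᵢ is the distance to the source of Aᵢ, truncated at len Aᵢ.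
-- As the distances cannot be chosen uniformly in x (that would need the double negation shift),
-- the form lives on the graph of vertices labelled with the four distances in question.
module Collars
  (G : Graph) (A₀ A₂ : Geodesic G) (W : ℕ) (far : Far A₀ A₂ (W + W))
  where

  open Graph G
  open Walks G
  open Truncated G

  Collar Position : Geodesic G → V → Set
  Collar A   = TruncatedDistance (On A) W
  Position A = TruncatedDistance (source A ≡_) (len A)

  record Label (x : V) : Set where
    constructor label
    field
      t₀ : Collar A₀ x
      t₂ : Collar A₂ x
      g₀ : Position A₀ x
      g₂ : Position A₂ x
  open Label

  labels : ∀ x → ¬ ¬ Label x
  labels x = exists x >>= λ t₀ → exists x >>= λ t₂ → exists x >>= λ g₀ → exists x >>= λ g₂ →
    return (label t₀ t₂ g₀ g₂)

  labels-unique : ∀ {x} (l l′ : Label x) → l ≡ l′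
  labels-unique (label t₀ t₂ g₀ g₂) (label t₀′ t₂′ g₀′ g₂′)
    rewrite unique t₀ t₀′ | unique t₂ t₂′ | unique g₀ g₀′ | unique g₂ g₂′ = refl

  labelled : Graph
  labelled = record
    { V    = Σ V Label
    ; _∼_  = λ x y → proj₁ x ∼ proj₁ y
    ; sym∼ = sym∼
    ; irr∼ = irr∼
    }

  forget : ∀ {x y n} → Walk labelled x y n → Walk G (proj₁ x) (proj₁ y) n
  forget here       = here
  forget (step e w) = step e (forget w)

  -- Labels are chosen one vertex at a time, so finitely many double negations suffice; at the end,
  -- uniqueness identifies the label reached with the prescribed one.
  lift : ∀ {x y n} → Walk G x y n → ∀ l l′ → ¬ ¬ Walk labelled (x , l) (y , l′) n
  lift here               l l′ = return (subst (λ m → Walk labelled _ (_ , m) 0) (labels-unique l l′) here)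
  lift (step {y = z} e w) l l′ = labels z >>= λ m → lift w m l′ >>= λ w′ → return (step e w′)

  V̂ : Set
  V̂ = Σ V Label

  f₀ f₂ ĝ₀ ĝ₂ : V̂ → ℤ
  f₀ (_ , l) = + W ℤ.- + value (t₀ l)
  f₂ (_ , l) = + W ℤ.- + value (t₂ l)
  ĝ₀ (_ , l) = + value (g₀ l)
  ĝ₂ (_ , l) = + value (g₂ l)

  -- The discrete form f₀ dg₀ + f₂ dg₂, with coefficients taken at the first end of the edge.
  ω : V̂ → V̂ → ℤ
  ω x y = f₀ x ℤ.* (ĝ₀ y ℤ.- ĝ₀ x) ℤ.+ f₂ x ℤ.* (ĝ₂ y ℤ.- ĝ₂ x)

  -- A local primitive: freezing the coefficients at `u` makes the form exact.
  φ : V̂ → V̂ → ℤ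
  φ u x = f₀ u ℤ.* ĝ₀ x ℤ.+ f₂ u ℤ.* ĝ₂ x

  increment≤1 : ∀ {S N x y} (p : TruncatedDistance S N x) (q : TruncatedDistance S N y) → x ∼ y →
                ∣ + value q ℤ.- + value p ∣ ≤ 1
  increment≤1 p q e = ∣+m-+n∣≤ (lipschitz p q (step e here)) (lipschitz q p (step (sym∼ e) here))

  on-far : ∀ y z → On A₀ y → On A₂ z → ∀ m → Walk G y z m → W + W ≤ m
  on-far _ _ (i , i≤ , refl) (j , j≤ , refl) m w = far i j i≤ j≤ w

  separated : ∀ {x x′ m} (p : Collar A₀ x) (q : Collar A₂ x′) → Walk G x x′ m →
              value p < W → value q < W → W + W ≤ value p + m + value q
  separated p q = separated-values on-far p q

  -- Freezing the coefficients at `u` costs the variation of f₀ and f₂ between `u` and `x`, as each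
  -- dgᵢ is at most 1. Since the segments are 2 W apart, both variations together are at most the
  -- length `k` of the walk, not 2 k.
  ω-nearly-exact : ∀ s′ u {x y} → proj₁ x ∼ proj₁ y → InBall labelled s′ u x →
                   ∣ ω x y ℤ.- (φ u y ℤ.- φ u x) ∣ ≤ s′
  ω-nearly-exact s′ u@(_ , l) {x@(_ , m)} {y@(_ , n)} e (k , k≤s′ , ŵ) = begin
    ∣ ω x y ℤ.- (φ u y ℤ.- φ u x) ∣
      ≡⟨ cong ∣_∣ (lem (+ W) (τ₀ l) (τ₀ m) (τ₂ l) (τ₂ m) (ĝ₀ x) (ĝ₀ y) (ĝ₂ x) (ĝ₂ y)) ⟩
    ∣ (τ₀ l ℤ.- τ₀ m) ℤ.* (ĝ₀ y ℤ.- ĝ₀ x) ℤ.+ (τ₂ l ℤ.- τ₂ m) ℤ.* (ĝ₂ y ℤ.- ĝ₂ x) ∣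
      ≤⟨ ∣i*k∣+∣j*l∣≤ (τ₀ l ℤ.- τ₀ m) _ (τ₂ l ℤ.- τ₂ m) _
           (increment≤1 (g₀ m) (g₀ n) e) (increment≤1 (g₂ m) (g₂ n) e) ⟩
    ∣ τ₀ l ℤ.- τ₀ m ∣ + ∣ τ₂ l ℤ.- τ₂ m ∣
      ≤⟨ ∣Δa∣+∣Δb∣≤ (value≤N (t₀ l)) (value≤N (t₀ m)) (value≤N (t₂ l)) (value≤N (t₂ m))
           (lipschitz (t₀ m) (t₀ l) w′) (lipschitz (t₀ l) (t₀ m) w)
           (lipschitz (t₂ m) (t₂ l) w′) (lipschitz (t₂ l) (t₂ m) w)
           (apart l) (apart m) (separated (t₀ l) (t₂ m) w) (separated (t₀ m) (t₂ l) w′) ⟩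
    k
      ≤⟨ k≤s′ ⟩
    s′ ∎
    where
    open ≤-Reasoning
    w  = forget ŵ
    w′ = reverse w
    τ₀ τ₂ : ∀ {x} → Label x → ℤ
    τ₀ l = + value (t₀ l)
    τ₂ l = + value (t₂ l)
    apart : ∀ {x} (l : Label x) → value (t₀ l) < W → value (t₂ l) < W →
            W + W ≤ value (t₀ l) + k + value (t₂ l)
    apart l p q = ≤-trans (separated (t₀ l) (t₂ l) here p q)
      (+-monoˡ-≤ (value (t₂ l)) (+-monoʳ-≤ (value (t₀ l)) z≤n))
    lem : ∀ W a a′ b b′ g g′ h h′ →
      ((W ℤ.- a′) ℤ.* (g′ ℤ.- g) ℤ.+ (W ℤ.- b′) ℤ.* (h′ ℤ.- h)) ℤ.-
      (((W ℤ.- a) ℤ.* g′ ℤ.+ (W ℤ.- b) ℤ.* h′) ℤ.- ((W ℤ.- a) ℤ.* g ℤ.+ (W ℤ.- b) ℤ.* h))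
      ≡ (a ℤ.- a′) ℤ.* (g′ ℤ.- g) ℤ.+ (b ℤ.- b′) ℤ.* (h′ ℤ.- h)
    lem = ℤ-Solver.solve-∀

  -- The collars are disjoint: the two truncated distances of a point add up to at least `W`, so f₀
  -- + f₂ ≤ W.
  ∣ω∣≤W : ∀ {x y} → proj₁ x ∼ proj₁ y → ∣ ω x y ∣ ≤ W
  ∣ω∣≤W {x@(_ , l)} {y@(_ , m)} e = begin
    ∣ ω x y ∣
      ≤⟨ ∣i*k∣+∣j*l∣≤ (f₀ x) _ (f₂ x) _ (increment≤1 (g₀ l) (g₀ m) e) (increment≤1 (g₂ l) (g₂ m) e) ⟩
    ∣ f₀ x ∣ + ∣ f₂ x ∣
      ≡⟨ cong₂ _+_ (∣+n-+m∣≡n∸m (value≤N (t₀ l))) (∣+n-+m∣≡n∸m (value≤N (t₂ l))) ⟩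
    (W ∸ a) + (W ∸ b)
      ≤⟨ +-cancelˡ-≤ (a + b) _ _ (≤-trans (≤-reflexive
           (trans (lem a b (W ∸ a) (W ∸ b))
             (cong₂ _+_ (m+[n∸m]≡n (value≤N (t₀ l))) (m+[n∸m]≡n (value≤N (t₂ l))))))
           (+-monoˡ-≤ W W≤a+b)) ⟩
    W ∎
    where
    open ≤-Reasoning
    a = value (t₀ l)
    b = value (t₂ l)
    lem : ∀ a b c d → a + b + (c + d) ≡ (a + c) + (b + d)
    lem = solve-∀
    W≤a+b : W ≤ a + b
    W≤a+b with a <? W | b <? W
    ... | no a≮W  | _       = ≤-trans (≮⇒≥ a≮W) (m≤m+n a b)
    ... | yes _   | no b≮W  = ≤-trans (≮⇒≥ b≮W) (m≤n+m b a)
    ... | yes a<W | yes b<W = ≤-trans (m≤m+n W W)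
      (≤-trans (separated (t₀ l) (t₂ l) here a<W b<W) (≤-reflexive (cong (_+ b) (+-identityʳ a))))

  open Walks.Integral labelled ω public

  ∣∮∣≤ : ∀ {x y n} (w : Walk labelled x y n) → ∣ ∮ w ∣ ≤ n * W
  ∣∮∣≤ here               = z≤n
  ∣∮∣≤ (step {x} {y} e w) = ∣a+b∣≤ {ω x y} (∣ω∣≤W {x} {y} e) (∣∮∣≤ w)

  -- The value on an edge is required for all labels because those of the inner points are only
  -- chosen along the way.
  constant-path : ∀ κ n (pt : ℕ → V) → (∀ k → k < n → pt k ∼ pt (suc k)) →
    (∀ k → k < n → ∀ l l′ → ω (pt k , l) (pt (suc k) , l′) ≡ κ) →
    ∀ l l′ → ¬ ¬ Σ (Walk labelled (pt 0 , l) (pt n , l′) n) λ w → ∮ w ≡ + n ℤ.* κ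
  constant-path κ zero pt adj const l l′ = return (closed (labels-unique l l′))
    where
    closed : ∀ {l′} → l ≡ l′ → Σ (Walk labelled (pt 0 , l) (pt 0 , l′) 0) λ w → ∮ w ≡ + 0 ℤ.* κ
    closed refl = here , refl
  constant-path κ (suc n) pt adj const l l′ =
    labels (pt 1) >>= λ m →
    constant-path κ n (λ k → pt (suc k)) (λ k k<n → adj (suc k) (s≤s k<n))
      (λ k k<n → const (suc k) (s≤s k<n)) m l′ >>= λ (w , eq) →
    return (step (adj 0 (s≤s z≤n)) w ,
      trans (cong₂ ℤ._+_ (const 0 (s≤s z≤n) l m) eq) (lem κ (+ n)))
    where
    lem : ∀ κ n → κ ℤ.+ n ℤ.* κ ≡ (+ 1 ℤ.+ n) ℤ.* κ
    lem = ℤ-Solver.solve-∀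

  collar-far : ∀ {A x} → (∀ i → i ≤ len A → ∀ {m} → Walk G (pt A i) x m → W ≤ m) →
               (p : Collar A x) → value p ≡ W
  collar-far x-far p = ≤-antisym (value≤N p)
    (≤value p ≤-refl λ { _ (i , i≤ , refl) m w → x-far i i≤ w })

  collar-on : ∀ {A x} → On A x → (p : Collar A x) → value p ≡ 0
  collar-on on p = n≤0⇒n≡0 (value≤walk p on here)

  position : ∀ {A k} → k ≤ len A → (p : Position A (pt A k)) → value p ≡ k
  position {A} {k} k≤n p = ≤-antisym (value≤walk p refl (initial A k k≤n))
    (≤value p k≤n λ { _ refl m w → isometric A z≤n k≤n w })

  -- Points of `B` lie outside both collars, where both coefficients vanish.
  path-far : (B : Geodesic G) → Far A₀ B W → Far A₂ B W → ∀ l l′ →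
             ¬ ¬ Σ (Walk labelled (source B , l) (target B , l′) (len B)) λ w → ∮ w ≡ + 0
  path-far B far₀ far₂ l l′ =
    constant-path (+ 0) (len B) (pt B) (adj B) const l l′ >>= λ (w , eq) →
    return (w , trans eq (ℤ.*-zeroʳ (+ len B)))
    where
    lem : ∀ W a b → (W ℤ.- W) ℤ.* a ℤ.+ (W ℤ.- W) ℤ.* b ≡ + 0
    lem = ℤ-Solver.solve-∀
    const : ∀ k → k < len B → ∀ l l′ → ω (pt B k , l) (pt B (suc k) , l′) ≡ + 0
    const k k<n l l′
      rewrite collar-far {A₀} (λ i i≤ → far₀ i k i≤ (<⇒≤ k<n)) (t₀ l)
            | collar-far {A₂} (λ i i≤ → far₂ i k i≤ (<⇒≤ k<n)) (t₂ l) = lem (+ W) _ _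

  -- On `A₀` the coefficient f₀ equals `W`, g₀ grows by 1 along each edge, and f₂ vanishes.
  path-A₀ : ∀ l l′ → ¬ ¬ Σ (Walk labelled (source A₀ , l) (target A₀ , l′) (len A₀)) λ w →
            ∮ w ≡ + len A₀ ℤ.* + W
  path-A₀ = constant-path (+ W) (len A₀) (pt A₀) (adj A₀) const
    where
    lem : ∀ W k a → (W ℤ.- + 0) ℤ.* ((+ 1 ℤ.+ k) ℤ.- k) ℤ.+ (W ℤ.- W) ℤ.* a ≡ W
    lem = ℤ-Solver.solve-∀
    const : ∀ k → k < len A₀ → ∀ l l′ → ω (pt A₀ k , l) (pt A₀ (suc k) , l′) ≡ + W
    const k k<n l l′
      rewrite collar-on {A₀} (k , <⇒≤ k<n , refl) (t₀ l)
            | collar-far {A₂} (λ i i≤ w → ≤-trans (m≤m+n W W) (far k i (<⇒≤ k<n) i≤ (reverse w))) (t₂ l)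
            | position {A₀} (<⇒≤ k<n) (g₀ l) | position {A₀} k<n (g₀ l′) = lem (+ W) (+ k) _

  path-A₂ : ∀ l l′ → ¬ ¬ Σ (Walk labelled (source A₂ , l) (target A₂ , l′) (len A₂)) λ w →
            ∮ w ≡ + len A₂ ℤ.* + W
  path-A₂ = constant-path (+ W) (len A₂) (pt A₂) (adj A₂) const
    where
    lem : ∀ W k a → (W ℤ.- W) ℤ.* a ℤ.+ (W ℤ.- + 0) ℤ.* ((+ 1 ℤ.+ k) ℤ.- k) ≡ W
    lem = ℤ-Solver.solve-∀
    const : ∀ k → k < len A₂ → ∀ l l′ → ω (pt A₂ k , l) (pt A₂ (suc k) , l′) ≡ + W
    const k k<n l l′
      rewrite collar-on {A₂} (k , <⇒≤ k<n , refl) (t₂ l)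
            | collar-far {A₀} (λ i i≤ w → ≤-trans (m≤m+n W W) (far i k i≤ (<⇒≤ k<n) w)) (t₀ l)
            | position {A₂} (<⇒≤ k<n) (g₂ l) | position {A₂} k<n (g₂ l′) = lem (+ W) (+ k) _

-- Octagons and the collar bound.

Chord : {G : Graph} → ℕ → Geodesic G → Geodesic G → Set
Chord {G} W A B = ∃ λ m → m ≤ W × Walk G (target A) (source B) m

-- Both pairs of opposite segments are 2 W apart, so that after a rotation the collar form serves
-- the other pair.
record Octagon (G : Graph) (W : ℕ) : Set where
  field
    A₀ A₁ A₂ A₃ : Geodesic G
    chord₀      : Chord W A₀ A₁
    chord₁      : Chord W A₁ A₂
    chord₂      : Chord W A₂ A₃
    chord₃      : Chord W A₃ A₀
    far₀₁       : Far A₀ A₁ W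
    far₁₂       : Far A₁ A₂ W
    far₂₃       : Far A₂ A₃ W
    far₃₀       : Far A₃ A₀ W
    far₀₂       : Far A₀ A₂ (W + W)
    far₁₃       : Far A₁ A₃ (W + W)

  perimeter : ℕ
  perimeter = len A₀ + len A₁ + len A₂ + len A₃ + 4 * W

rotate-octagon : ∀ {G W} → Octagon G W → Octagon G W
rotate-octagon O = record
  { A₀ = A₁ ; A₁ = A₂ ; A₂ = A₃ ; A₃ = A₀
  ; chord₀ = chord₁ ; chord₁ = chord₂ ; chord₂ = chord₃ ; chord₃ = chord₀
  ; far₀₁ = far₁₂ ; far₁₂ = far₂₃ ; far₂₃ = far₃₀ ; far₃₀ = far₀₁
  ; far₀₂ = far₁₃ ; far₁₃ = Far-sym {A = A₀} {A₂} far₀₂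
  }
  where open Octagon O

module OctagonArea
  (G : Graph) (s s′ d M : ℕ) (s≡s′+d : s ≡ s′ + d) (0<d : 0 < d)
  (2as′≤dM : 2 * ((s + s′) * s′) ≤ d * M) (dismantlable : Dismantlable G s s′)
  where

  open Graph G
  open WellOrder (proj₁ dismantlable)

  _≼_ : V → V → Set
  x ≼ y = x ≺ y ⊎ x ≡ y

  ≼-total : ∀ x y → x ≼ y ⊎ y ≼ x
  ≼-total x y with total x y
  ... | inj₁ x≺y        = inj₁ (inj₁ x≺y)
  ... | inj₂ (inj₁ x≡y) = inj₁ (inj₂ x≡y)
  ... | inj₂ (inj₂ y≺x) = inj₂ (inj₁ y≺x)

  ≼-trans : ∀ {x y z} → x ≼ y → y ≼ z → x ≼ z
  ≼-trans (inj₁ x≺y)  (inj₁ y≺z)  = inj₁ (trans≺ x≺y y≺z)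
  ≼-trans (inj₁ x≺y)  (inj₂ refl) = inj₁ x≺y
  ≼-trans (inj₂ refl) y≼z         = y≼z

  module _ (W : ℕ) (O : Octagon G W) where
    open Octagon O
    open Collars G A₀ A₂ W far₀₂

    dominated : ∀ (v w : V̂) → proj₁ w ∼ proj₁ v → proj₁ w ≼ proj₁ v → ¬ ¬ ∃ λ u → ∀ x →
                InBall labelled s v x → proj₁ x ≼ proj₁ v → ¬ ¬ InBall labelled s′ u x
    -- Labels of one vertex are tied in the preorder, but neighbours have distinct underlying
    -- vertices. So `w` is strictly below `v`, and `v` is not the least vertex.
    dominated (v , _) (w , _) w∼v (inj₂ refl) = contradiction w∼v irr∼
    dominated v̂@(v , _) (w , _) w∼v (inj₁ w≺v) with proj₂ dismantlable v (w , w≺v)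
    ... | u , _ , _ , ball = labels u >>= λ l → return ((u , l) , near l)
      where
      near : ∀ l x → InBall labelled s v̂ x → proj₁ x ≼ v → ¬ ¬ InBall labelled s′ (u , l) x
      near l (x , m) (n , n≤s , w) x≼v with ball x (n , n≤s , forget w) x≼v
      ... | k , k≤s′ , w′ = lift w′ l m >>= λ ŵ → return (k , k≤s′ , ŵ)

    -- The hypothesis on `M` says that the isoperimetric slope (s + s′) s′ / d is at most M / 2.
    2∣∮∣≤M*n : ∀ {x n} (c : Walk labelled x x n) → 2 * ∣ ∮ c ∣ ≤ M * n
    2∣∮∣≤M*n {x} {n} c = *-cancelˡ-≤ d {{>-nonZero 0<d}} (begin
      d * (2 * ∣ ∮ c ∣)               ≡⟨ lem d ∣ ∮ c ∣ ⟩
      2 * (d * ∣ ∮ c ∣)               ≤⟨ *-monoʳ-≤ 2 (area n c) ⟩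
      2 * ((s + s′) * s′ * n)         ≡⟨ *-assoc 2 ((s + s′) * s′) n ⟨
      2 * ((s + s′) * s′) * n         ≤⟨ *-monoˡ-≤ n 2as′≤dM ⟩
      d * M * n                       ≡⟨ *-assoc d M n ⟩
      d * (M * n)                     ∎)
      where
      open ≤-Reasoning
      open Area labelled (λ x y → proj₁ x ≼ proj₁ y) (λ x y → ≼-total (proj₁ x) (proj₁ y))
        (inj₂ refl) ≼-trans s s′ d s≡s′+d 0<d dominated ω φ (ω-nearly-exact s′) using (area)
      lem : ∀ d i → d * (2 * i) ≡ 2 * (d * i)
      lem = solve-∀

    -- `A₀` and `A₂` both count positively, as each gᵢ grows along its own segment; `A₁` and `A₃`
    -- contribute nothing, and each of the four chords at most W². The integral around the whole
    -- octagon is at most M / 2 times the perimeter.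
    collar-bound : 2 * (W * (len A₀ + len A₂)) ≤ 8 * (W * W) + M * perimeter
    collar-bound = ≤-stable (
      labels (source A₀) >>= λ a₀ → labels (target A₀) >>= λ b₀ →
      labels (source A₁) >>= λ a₁ → labels (target A₁) >>= λ b₁ →
      labels (source A₂) >>= λ a₂ → labels (target A₂) >>= λ b₂ →
      labels (source A₃) >>= λ a₃ → labels (target A₃) >>= λ b₃ →
      path-A₀ a₀ b₀ >>= λ (p₀ , ∮p₀) →
      path-far A₁ far₀₁ (Far-sym {A = A₁} {A₂} far₁₂) a₁ b₁ >>= λ (p₁ , ∮p₁) →
      path-A₂ a₂ b₂ >>= λ (p₂ , ∮p₂) →
      path-far A₃ (Far-sym {A = A₃} {A₀} far₃₀) far₂₃ a₃ b₃ >>= λ (p₃ , ∮p₃) →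
      lift (proj₂ (proj₂ chord₀)) b₀ a₁ >>= λ q₀ →
      lift (proj₂ (proj₂ chord₁)) b₁ a₂ >>= λ q₁ →
      lift (proj₂ (proj₂ chord₂)) b₂ a₃ >>= λ q₂ →
      lift (proj₂ (proj₂ chord₃)) b₃ a₀ >>= λ q₃ →
      return (around p₀ ∮p₀ p₁ ∮p₁ p₂ ∮p₂ p₃ ∮p₃
        (proj₁ (proj₂ chord₀)) q₀ (proj₁ (proj₂ chord₁)) q₁
        (proj₁ (proj₂ chord₂)) q₂ (proj₁ (proj₂ chord₃)) q₃))
      where
      open Walks labelled using (_++_)
      module _
        {x₀ y₀ x₁ y₁ x₂ y₂ x₃ y₃}
        (p₀ : Walk labelled x₀ y₀ (len A₀)) (∮p₀ : ∮ p₀ ≡ + len A₀ ℤ.* + W)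
        (p₁ : Walk labelled x₁ y₁ (len A₁)) (∮p₁ : ∮ p₁ ≡ + 0)
        (p₂ : Walk labelled x₂ y₂ (len A₂)) (∮p₂ : ∮ p₂ ≡ + len A₂ ℤ.* + W)
        (p₃ : Walk labelled x₃ y₃ (len A₃)) (∮p₃ : ∮ p₃ ≡ + 0)
        {n₀} (n₀≤ : n₀ ≤ W) (q₀ : Walk labelled y₀ x₁ n₀) {n₁} (n₁≤ : n₁ ≤ W) (q₁ : Walk labelled y₁ x₂ n₁)
        {n₂} (n₂≤ : n₂ ≤ W) (q₂ : Walk labelled y₂ x₃ n₂) {n₃} (n₃≤ : n₃ ≤ W) (q₃ : Walk labelled y₃ x₀ n₃)
        where
        open ≤-Reasoning
        n = len A₀ + (n₀ + (len A₁ + (n₁ + (len A₂ + (n₂ + (len A₃ + n₃))))))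
        loop : Walk labelled x₀ x₀ n
        loop = p₀ ++ q₀ ++ p₁ ++ q₁ ++ p₂ ++ q₂ ++ p₃ ++ q₃
        chords : ℤ
        chords = (∮ q₀ ℤ.+ ∮ q₁) ℤ.+ (∮ q₂ ℤ.+ ∮ q₃)

        ∮-loop : + len A₀ ℤ.* + W ℤ.+ + len A₂ ℤ.* + W ≡ ∮ loop ℤ.- chords
        ∮-loop
          rewrite ∮-++ p₀ (q₀ ++ p₁ ++ q₁ ++ p₂ ++ q₂ ++ p₃ ++ q₃)
                | ∮-++ q₀ (p₁ ++ q₁ ++ p₂ ++ q₂ ++ p₃ ++ q₃)
                | ∮-++ p₁ (q₁ ++ p₂ ++ q₂ ++ p₃ ++ q₃)
                | ∮-++ q₁ (p₂ ++ q₂ ++ p₃ ++ q₃)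
                | ∮-++ p₂ (q₂ ++ p₃ ++ q₃)
                | ∮-++ q₂ (p₃ ++ q₃)
                | ∮-++ p₃ q₃
                | ∮p₀ | ∮p₁ | ∮p₂ | ∮p₃ =
          lem (+ len A₀ ℤ.* + W) (+ len A₂ ℤ.* + W) (∮ q₀) (∮ q₁) (∮ q₂) (∮ q₃)
          where
          lem : ∀ a b i j k l → a ℤ.+ b ≡
            (a ℤ.+ (i ℤ.+ (+ 0 ℤ.+ (j ℤ.+ (b ℤ.+ (k ℤ.+ (+ 0 ℤ.+ l))))))) ℤ.-
            ((i ℤ.+ j) ℤ.+ (k ℤ.+ l))
          lem = ℤ-Solver.solve-∀

        n≤perimeter : n ≤ perimeter
        n≤perimeter = begin
          n ≤⟨ +-monoʳ-≤ (len A₀) (+-mono-≤ n₀≤ (+-monoʳ-≤ (len A₁) (+-mono-≤ n₁≤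
                 (+-monoʳ-≤ (len A₂) (+-mono-≤ n₂≤ (+-monoʳ-≤ (len A₃) n₃≤)))))) ⟩
          len A₀ + (W + (len A₁ + (W + (len A₂ + (W + (len A₃ + W))))))
            ≡⟨ lem (len A₀) (len A₁) (len A₂) (len A₃) W ⟩
          perimeter ∎
          where
          lem : ∀ a b c d W → a + (W + (b + (W + (c + (W + (d + W)))))) ≡ a + b + c + d + 4 * W
          lem = solve-∀

        ∣∮q∣≤ : ∀ {x y m} (q : Walk labelled x y m) → m ≤ W → ∣ ∮ q ∣ ≤ W * W
        ∣∮q∣≤ q m≤W = ≤-trans (∣∮∣≤ q) (*-monoˡ-≤ W m≤W)

        around : 2 * (W * (len A₀ + len A₂)) ≤ 8 * (W * W) + M * perimeter
        around = begin
          2 * (W * (len A₀ + len A₂))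
            ≡⟨ cong (2 *_) (trans (*-comm W _) (*-distribʳ-+ W (len A₀) (len A₂))) ⟩
          2 * (len A₀ * W + len A₂ * W)
            ≡⟨ cong (λ i → 2 * ∣ i ∣) (cong₂ ℤ._+_ (ℤ.pos-* (len A₀) W) (ℤ.pos-* (len A₂) W)) ⟩
          2 * ∣ + len A₀ ℤ.* + W ℤ.+ + len A₂ ℤ.* + W ∣
            ≡⟨ cong (λ i → 2 * ∣ i ∣) ∮-loop ⟩
          2 * ∣ ∮ loop ℤ.- chords ∣
            ≤⟨ *-monoʳ-≤ 2 (∣a-b∣≤ {∮ loop} ≤-refl
                 (∣a+b∣≤ {∮ q₀ ℤ.+ ∮ q₁} (∣a+b∣≤ {∮ q₀} (∣∮q∣≤ q₀ n₀≤) (∣∮q∣≤ q₁ n₁≤))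
                                         (∣a+b∣≤ {∮ q₂} (∣∮q∣≤ q₂ n₂≤) (∣∮q∣≤ q₃ n₃≤)))) ⟩
          2 * (∣ ∮ loop ∣ + ((W * W + W * W) + (W * W + W * W)))
            ≡⟨ lem ∣ ∮ loop ∣ (W * W) ⟩
          8 * (W * W) + 2 * ∣ ∮ loop ∣
            ≤⟨ +-monoʳ-≤ (8 * (W * W)) (≤-trans (2∣∮∣≤M*n loop) (*-monoʳ-≤ M n≤perimeter)) ⟩
          8 * (W * W) + M * perimeter ∎
          where
          lem : ∀ i w → 2 * (i + ((w + w) + (w + w))) ≡ 8 * w + 2 * i
          lem = solve-∀

-- Cutting the corners of a quadrilateral.

-- In the notation of the four-point condition, the vertices are u, x, v, y in cyclic order, and
-- d(u,v) + d(x,y) is the largest of the three sums.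
record Quadrilateral (G : Graph) (g : ℕ) : Set where
  field
    side₀ side₁ side₂ side₃ : Geodesic G
    joint₀                  : target side₀ ≡ source side₁
    joint₁                  : target side₁ ≡ source side₂
    joint₂                  : target side₂ ≡ source side₃
    joint₃                  : target side₃ ≡ source side₀
    D₀ D₁                   : ℕ
    diagonal₀               : ∀ {m} → Walk G (source side₀) (source side₂) m → D₀ ≤ m
    diagonal₁               : ∀ {m} → Walk G (source side₁) (source side₃) m → D₁ ≤ m
    gap₀                    : len side₀ + len side₂ + g ≤ D₀ + D₁
    gap₁                    : len side₁ + len side₃ + g ≤ D₀ + D₁

module _ {G : Graph} where
  open Graph G
  open Walks G

  rotate-quadrilateral : ∀ {g} → Quadrilateral G g → Quadrilateral G g
  rotate-quadrilateral {g} Q = record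
    { side₀ = side₁ ; side₁ = side₂ ; side₂ = side₃ ; side₃ = side₀
    ; joint₀ = joint₁ ; joint₁ = joint₂ ; joint₂ = joint₃ ; joint₃ = joint₀
    ; D₀ = D₁ ; D₁ = D₀ ; diagonal₀ = diagonal₁ ; diagonal₁ = λ w → diagonal₀ (reverse w)
    ; gap₀ = ≤-trans gap₁ (≤-reflexive (+-comm D₀ D₁))
    ; gap₁ = begin
        len side₂ + len side₀ + g  ≡⟨ cong (_+ g) (+-comm (len side₂) (len side₀)) ⟩
        len side₀ + len side₂ + g  ≤⟨ gap₀ ⟩
        D₀ + D₁                    ≡⟨ +-comm D₀ D₁ ⟩
        D₁ + D₀                    ∎
    }
    where
    open Quadrilateral Q
    open ≤-Reasoning

  -- Both diagonals can be rerouted through a connecting walk of length `m`. The two routes cover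
  -- the two sides once and the walk twice, so `gap₀` gives g ≤ 2 m.
  opposite-far : ∀ {g} (Q : Quadrilateral G g) → let open Quadrilateral Q in
                 ∀ D → D + D ≤ g → Far side₀ side₂ D
  opposite-far {g} Q D 2D≤g i j i≤ j≤ {m} w = half (+-cancelˡ-≤ (a + b) _ _ (begin
      a + b + (D + D)            ≤⟨ +-monoʳ-≤ (a + b) 2D≤g ⟩
      a + b + g                  ≤⟨ gap₀ ⟩
      D₀ + D₁                    ≤⟨ +-mono-≤ through₀ through₁ ⟩
      (i + (m + j)) + ((a ∸ i) + (m + (b ∸ j)))
                                 ≡⟨ lem i j m (a ∸ i) (b ∸ j) ⟩
      (i + (a ∸ i)) + (j + (b ∸ j)) + (m + m)
                                 ≡⟨ cong₂ (λ p q → p + q + (m + m)) (m+[n∸m]≡n i≤) (m+[n∸m]≡n j≤) ⟩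
      a + b + (m + m)            ∎))
    where
    open Quadrilateral Q
    open ≤-Reasoning
    a = len side₀
    b = len side₂
    half : D + D ≤ m + m → D ≤ m
    half le = ≮⇒≥ λ m<D → <⇒≱ (+-mono-< m<D m<D) le
    through₀ : D₀ ≤ i + (m + j)
    through₀ = diagonal₀ (initial side₀ i i≤ ++ w ++ reverse (initial side₂ j j≤))
    through₁ : D₁ ≤ (a ∸ i) + (m + (b ∸ j))
    through₁ = diagonal₁ (subst₂ (λ x y → Walk G x y _) joint₀ joint₂
      (reverse (remainder side₀ i i≤) ++ w ++ remainder side₂ j j≤))
    lem : ∀ i j m p q → (i + (m + j)) + (p + (m + q)) ≡ (i + p) + (j + q) + (m + m)
    lem = solve-∀

  -- The corner between A and B is cut off at the last point of B within W of A.
  record Cut (W : ℕ) (A B : Geodesic G) : Set where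
    field
      p e m  : ℕ
      p≤     : p ≤ len B
      e≤     : e ≤ len A
      m≤W    : m ≤ W
      chord  : Walk G (pt A e) (pt B p) m
      beyond : ∀ i k → i ≤ len A → p < k → k ≤ len B → ∀ {n} → Walk G (pt A i) (pt B k) n → W < n

  cut : ∀ W (A B : Geodesic G) → target A ≡ source B → ¬ ¬ Cut W A B
  cut W A B joint = last Close (len A , 0 , ≤-refl , z≤n , subst (λ x → Walk G (target A) x 0) joint here)
                      (len B) >>= λ (p , p≤ , (e , m , e≤ , m≤W , w) , beyond) → return record
    { p = p ; e = e ; m = m ; p≤ = p≤ ; e≤ = e≤ ; m≤W = m≤W ; chord = w
    ; beyond = λ i k i≤ p<k k≤ {n} w → ≰⇒> λ n≤W → beyond k p<k k≤ (i , n , i≤ , n≤W , w)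
    }
    where
    Close : ℕ → Set
    Close k = ∃ λ e → ∃ λ m → e ≤ len A × m ≤ W × Walk G (pt A e) (pt B k) m

  -- Points after `p` are farther than `W` from `A`; the point at `p` is one edge before such a
  -- point, hence still at distance at least `W`.
  cut-far : ∀ {W A B} (c : Cut W A B) → let open Cut c in p < len B →
            ∀ i k → i ≤ len A → p ≤ k → k ≤ len B → ∀ {n} → Walk G (pt A i) (pt B k) n → W ≤ n
  cut-far {W} {A} {B} c p<len i k i≤ p≤k k≤ {n} w with m≤n⇒m<n∨m≡n p≤k
  ... | inj₁ p<k  = <⇒≤ (Cut.beyond c i k i≤ p<k k≤ w)
  ... | inj₂ refl = ≤-pred (Cut.beyond c i (suc k) i≤ ≤-refl p<len (snoc w (adj B k p<len)))

  module _ {g W} (Q : Quadrilateral G g)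
           (c₀ : Cut W (Quadrilateral.side₃ Q) (Quadrilateral.side₀ Q))
           (c₁ : Cut W (Quadrilateral.side₀ Q) (Quadrilateral.side₁ Q)) where
    open Quadrilateral Q
    private
      module c₀ = Cut c₀
      module c₁ = Cut c₁
      n₀ = len side₀
      n₁ = len side₁
      n₃ = len side₃

    -- Four estimates are combined with `gap₁`. Each diagonal is at most the way through one chord
    -- (`across₀`, `across₁`); the parts of the geodesic `side₀` after the second cut and before the
    -- first are at most the way over the chord and the neighbouring side (`near₁`, `near₃`). Each
    -- estimate crosses one chord, whence 4 W.
    cuts-uncrossed : g + 2 * c₀.p ≤ 2 * c₁.e + 4 * W
    cuts-uncrossed = +-cancelˡ-≤ K _ _ (begin
      K + (g + 2 * c₀.p)
        ≡⟨ lem₁ n₀ n₁ n₃ g c₀.p c₁.p c₀.e ⟩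
      (n₁ + n₃ + g) + (c₁.p + c₀.p + (n₀ + (c₀.p + c₀.e)))
        ≤⟨ +-monoˡ-≤ _ gap₁ ⟩
      (D₀ + D₁) + (c₁.p + c₀.p + (n₀ + (c₀.p + c₀.e)))
        ≡⟨ lem₂ D₀ D₁ c₁.p c₀.p n₀ c₀.e ⟩
      (D₀ + c₁.p) + (D₁ + c₀.p) + (n₀ + (c₀.p + c₀.e))
        ≤⟨ +-mono-≤ (+-mono-≤ across₀ across₁) (+-mono-≤ near₁ near₃) ⟩
      (c₁.e + W + n₁) + (n₀ + W + c₀.e) + ((c₁.e + W + c₁.p) + (n₃ + W))
        ≡⟨ lem₃ n₀ n₁ n₃ W c₁.e c₁.p c₀.e ⟩
      K + (2 * c₁.e + 4 * W) ∎)
      where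
      open ≤-Reasoning
      K = n₀ + n₁ + n₃ + c₁.p + c₀.e
      lem₁ : ∀ a b c g p q e → (a + b + c + q + e) + (g + 2 * p) ≡ (b + c + g) + (q + p + (a + (p + e)))
      lem₁ = solve-∀
      lem₂ : ∀ D E q p n e → (D + E) + (q + p + (n + (p + e))) ≡ (D + q) + (E + p) + (n + (p + e))
      lem₂ = solve-∀
      lem₃ : ∀ a b c W e q f → (e + W + b) + (a + W + f) + ((e + W + q) + (c + W)) ≡
                               (a + b + c + q + f) + (2 * e + 4 * W)
      lem₃ = solve-∀
      cancel : ∀ {D a b n p} → p ≤ n → D ≤ a + b + (n ∸ p) → D + p ≤ a + b + n
      cancel {D} {a} {b} {n} {p} p≤n le = begin
        D + p                ≤⟨ +-monoˡ-≤ p le ⟩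
        a + b + (n ∸ p) + p  ≡⟨ +-assoc (a + b) (n ∸ p) p ⟩
        a + b + (n ∸ p + p)  ≡⟨ cong (λ i → a + b + i) (m∸n+n≡m p≤n) ⟩
        a + b + n            ∎
      across₀ : D₀ + c₁.p ≤ c₁.e + W + n₁
      across₀ = cancel {a = c₁.e} {W} c₁.p≤ (≤-trans
        (diagonal₀ (subst (λ y → Walk G (source side₀) y _) joint₁
          ((initial side₀ c₁.e c₁.e≤ ++ c₁.chord) ++ remainder side₁ c₁.p c₁.p≤)))
        (+-monoˡ-≤ (n₁ ∸ c₁.p) (+-monoʳ-≤ c₁.e c₁.m≤W)))
      across₁ : D₁ + c₀.p ≤ n₀ + W + c₀.e
      across₁ = ≤-trans (cancel {a = c₀.e} {W} c₀.p≤ (≤-trans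
        (diagonal₁ (reverse (subst (λ y → Walk G (source side₃) y _) joint₀
          ((initial side₃ c₀.e c₀.e≤ ++ c₀.chord) ++ remainder side₀ c₀.p c₀.p≤))))
        (+-monoˡ-≤ (n₀ ∸ c₀.p) (+-monoʳ-≤ c₀.e c₀.m≤W)))) (≤-reflexive (lem c₀.e W n₀))
        where
        lem : ∀ e W n → e + W + n ≡ n + W + e
        lem = solve-∀
      near₁ : n₀ ≤ c₁.e + W + c₁.p
      near₁ = ≤-trans (isometric side₀ c₁.e≤ ≤-refl
        (subst (λ y → Walk G (pt side₀ c₁.e) y _) (sym joint₀)
          (c₁.chord ++ reverse (initial side₁ c₁.p c₁.p≤))))
        (≤-trans (≤-reflexive (sym (+-assoc c₁.e c₁.m c₁.p)))
          (+-monoˡ-≤ c₁.p (+-monoʳ-≤ c₁.e c₁.m≤W)))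
      near₃ : c₀.p + c₀.e ≤ n₃ + W
      near₃ = begin
        c₀.p + c₀.e                 ≤⟨ +-monoˡ-≤ c₀.e (isometric side₀ z≤n c₀.p≤
                                         (subst (λ x → Walk G x (pt side₀ c₀.p) _) joint₃
                                           (reverse (remainder side₃ c₀.e c₀.e≤) ++ c₀.chord))) ⟩
        n₃ ∸ c₀.e + c₀.m + c₀.e     ≡⟨ lem (n₃ ∸ c₀.e) c₀.m c₀.e ⟩
        n₃ ∸ c₀.e + c₀.e + c₀.m     ≡⟨ cong (_+ c₀.m) (m∸n+n≡m c₀.e≤) ⟩
        n₃ + c₀.m                   ≤⟨ +-monoʳ-≤ n₃ c₀.m≤W ⟩
        n₃ + W                      ∎
        where
        lem : ∀ a b c → a + b + c ≡ a + c + b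
        lem = solve-∀

    cuts-ordered : 4 * W < g → c₀.p < c₁.e
    cuts-ordered 4W<g = ≰⇒> λ e≤p → <⇒≱ 4W<g (+-cancelʳ-≤ (2 * c₀.p) _ _ (begin
      g + 2 * c₀.p        ≤⟨ cuts-uncrossed ⟩
      2 * c₁.e + 4 * W    ≤⟨ +-monoˡ-≤ (4 * W) (*-monoʳ-≤ 2 e≤p) ⟩
      2 * c₀.p + 4 * W    ≡⟨ +-comm (2 * c₀.p) (4 * W) ⟩
      4 * W + 2 * c₀.p    ∎))
      where open ≤-Reasoning

    cuts-apart : 4 * W < g → g ≤ 2 * (c₁.e ∸ c₀.p) + 4 * W
    cuts-apart 4W<g = +-cancelʳ-≤ (2 * c₀.p) _ _ (begin
      g + 2 * c₀.p
        ≤⟨ cuts-uncrossed ⟩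
      2 * c₁.e + 4 * W
        ≡⟨ cong (λ i → 2 * i + 4 * W) (m∸n+n≡m (<⇒≤ (cuts-ordered 4W<g))) ⟨
      2 * (c₁.e ∸ c₀.p + c₀.p) + 4 * W
        ≡⟨ lem (c₁.e ∸ c₀.p) c₀.p (4 * W) ⟩
      2 * (c₁.e ∸ c₀.p) + 4 * W + 2 * c₀.p ∎)
      where
      open ≤-Reasoning
      lem : ∀ a b c → 2 * (a + b) + c ≡ 2 * a + c + 2 * b
      lem = solve-∀

module _ {G : Graph} {A B : Geodesic G} {W : ℕ} (c : Cut W A B) where
  open Cut c

  module _ {i j} (i<e : i < e) (p<j : p < j) (j≤ : j ≤ len B) where

    cut-chord : Chord W (segment A i e (<⇒≤ i<e) e≤) (segment B p j (<⇒≤ p<j) j≤)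
    cut-chord = m , m≤W , subst₂ (λ x y → Walk G x y m)
      (sym (target-segment A i e (<⇒≤ i<e) e≤)) (sym (source-segment B p j (<⇒≤ p<j) j≤)) chord

    cut-segments-far : Far (segment A i e (<⇒≤ i<e) e≤) (segment B p j (<⇒≤ p<j) j≤) W
    cut-segments-far k l k≤ l≤ =
      -- The strict inequality p < j ensures that the cut point is not the end of `B`.
      cut-far c (<-≤-trans p<j j≤) (i + k) (p + l)
        (within A i e (<⇒≤ i<e) e≤ k≤) (m≤m+n p l) (within B p j (<⇒≤ p<j) j≤ l≤)

segments-far : ∀ {G D} (A B : Geodesic G) → Far A B D →
               ∀ {i j k l} (i≤j : i ≤ j) (j≤ : j ≤ len A) (k≤l : k ≤ l) (l≤ : l ≤ len B) →
               Far (segment A i j i≤j j≤) (segment B k l k≤l l≤) D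
segments-far A B far {i} {j} {k} {l} i≤j j≤ k≤l l≤ p q p≤ q≤ =
  far (i + p) (k + q) (within A i j i≤j j≤ p≤) (within B k l k≤l l≤ q≤)

module Truncation
  {G : Graph} {g W : ℕ} (Q : Quadrilateral G g) (4W<g : 4 * W < g)
  (c₀ : Cut W (Quadrilateral.side₃ Q) (Quadrilateral.side₀ Q))
  (c₁ : Cut W (Quadrilateral.side₀ Q) (Quadrilateral.side₁ Q))
  (c₂ : Cut W (Quadrilateral.side₁ Q) (Quadrilateral.side₂ Q))
  (c₃ : Cut W (Quadrilateral.side₂ Q) (Quadrilateral.side₃ Q))
  where

  open Quadrilateral Q

  private
    module c₀ = Cut c₀
    module c₁ = Cut c₁
    module c₂ = Cut c₂
    module c₃ = Cut c₃
    Q₁ = rotate-quadrilateral Q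
    Q₂ = rotate-quadrilateral Q₁
    Q₃ = rotate-quadrilateral Q₂
    p₀<e₁ = cuts-ordered Q  c₀ c₁ 4W<g
    p₁<e₂ = cuts-ordered Q₁ c₁ c₂ 4W<g
    p₂<e₃ = cuts-ordered Q₂ c₂ c₃ 4W<g
    p₃<e₀ = cuts-ordered Q₃ c₃ c₀ 4W<g
    2[W+W]≤g : (W + W) + (W + W) ≤ g
    2[W+W]≤g = ≤-trans (≤-reflexive (lem W)) (<⇒≤ 4W<g)
      where
      lem : ∀ W → (W + W) + (W + W) ≡ 4 * W
      lem = solve-∀

  octagon : Octagon G W
  octagon = record
    { A₀ = segment side₀ c₀.p c₁.e (<⇒≤ p₀<e₁) c₁.e≤
    ; A₁ = segment side₁ c₁.p c₂.e (<⇒≤ p₁<e₂) c₂.e≤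
    ; A₂ = segment side₂ c₂.p c₃.e (<⇒≤ p₂<e₃) c₃.e≤
    ; A₃ = segment side₃ c₃.p c₀.e (<⇒≤ p₃<e₀) c₀.e≤
    ; chord₀ = cut-chord c₁ p₀<e₁ p₁<e₂ c₂.e≤
    ; chord₁ = cut-chord c₂ p₁<e₂ p₂<e₃ c₃.e≤
    ; chord₂ = cut-chord c₃ p₂<e₃ p₃<e₀ c₀.e≤
    ; chord₃ = cut-chord c₀ p₃<e₀ p₀<e₁ c₁.e≤
    ; far₀₁ = cut-segments-far c₁ p₀<e₁ p₁<e₂ c₂.e≤
    ; far₁₂ = cut-segments-far c₂ p₁<e₂ p₂<e₃ c₃.e≤
    ; far₂₃ = cut-segments-far c₃ p₂<e₃ p₃<e₀ c₀.e≤
    ; far₃₀ = cut-segments-far c₀ p₃<e₀ p₀<e₁ c₁.e≤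
    ; far₀₂ = segments-far side₀ side₂ (opposite-far Q (W + W) 2[W+W]≤g)
        (<⇒≤ p₀<e₁) c₁.e≤ (<⇒≤ p₂<e₃) c₃.e≤
    ; far₁₃ = segments-far side₁ side₃ (opposite-far Q₁ (W + W) 2[W+W]≤g)
        (<⇒≤ p₁<e₂) c₂.e≤ (<⇒≤ p₃<e₀) c₀.e≤
    }

  open Octagon octagon

  4g≤ : 4 * g ≤ 2 * (len A₀ + len A₁ + len A₂ + len A₃) + 16 * W
  4g≤ = begin
    4 * g
      ≡⟨ lem g ⟩
    (g + g) + (g + g)
      ≤⟨ +-mono-≤ (+-mono-≤ (cuts-apart Q c₀ c₁ 4W<g) (cuts-apart Q₁ c₁ c₂ 4W<g))
                  (+-mono-≤ (cuts-apart Q₂ c₂ c₃ 4W<g) (cuts-apart Q₃ c₃ c₀ 4W<g)) ⟩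
    ((2 * len A₀ + 4 * W) + (2 * len A₁ + 4 * W)) + ((2 * len A₂ + 4 * W) + (2 * len A₃ + 4 * W))
      ≡⟨ lem′ (len A₀) (len A₁) (len A₂) (len A₃) W ⟩
    2 * (len A₀ + len A₁ + len A₂ + len A₃) + 16 * W ∎
    where
    open ≤-Reasoning
    lem : ∀ g → 4 * g ≡ (g + g) + (g + g)
    lem = solve-∀
    lem′ : ∀ a b c d W →
      ((2 * a + 4 * W) + (2 * b + 4 * W)) + ((2 * c + 4 * W) + (2 * d + 4 * W)) ≡
      2 * (a + b + c + d) + 16 * W
    lem′ = solve-∀

-- The four-point condition.

Dist-sym : ∀ {G x y n} → Dist G x y n → Dist G y x n
Dist-sym {G} (w , shortest) = reverse w , λ m w′ → shortest m (reverse w′)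
  where open Walks G

-- Either `a` is itself one of the two minima, or `b` and `c` are.
≤-middle : ∀ {a b c m t} → a ⊓ b ≤ m → a ⊓ c ≤ m → a ≤ (b ⊔ c) + t → a ≤ m + t
≤-middle {a} {b} {c} {m} {t} ab≤m ac≤m a≤ with ≤-total a b | ≤-total a c
... | inj₁ a≤b | _        = ≤-trans (subst (_≤ m) (m≤n⇒m⊓n≡m a≤b) ab≤m) (m≤m+n m t)
... | inj₂ _   | inj₁ a≤c = ≤-trans (subst (_≤ m) (m≤n⇒m⊓n≡m a≤c) ac≤m) (m≤m+n m t)
... | inj₂ b≤a | inj₂ c≤a = ≤-trans a≤ (+-monoˡ-≤ t
  (⊔-lub (subst (_≤ m) (m≥n⇒m⊓n≡n b≤a) ab≤m) (subst (_≤ m) (m≥n⇒m⊓n≡n c≤a) ac≤m)))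

largest≤middle : ∀ a b c t → a ≤ (b ⊔ c) + t → b ≤ (a ⊔ c) + t → c ≤ (a ⊔ b) + t →
                 a ⊔ b ⊔ c ≤ ((a ⊓ b) ⊔ (b ⊓ c) ⊔ (a ⊓ c)) + t
largest≤middle a b c t a≤ b≤ c≤ = ⊔-lub (⊔-lub
  (≤-middle ab ac a≤)
  (≤-middle (subst (_≤ m) (⊓-comm a b) ab) bc b≤))
  (≤-middle (subst (_≤ m) (⊓-comm a c) ac) (subst (_≤ m) (⊓-comm b c) bc) c≤)
  where
  m = (a ⊓ b) ⊔ (b ⊓ c) ⊔ (a ⊓ c)
  ab : a ⊓ b ≤ m
  ab = ≤-trans (m≤m⊔n (a ⊓ b) (b ⊓ c)) (m≤m⊔n _ (a ⊓ c))
  bc : b ⊓ c ≤ m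
  bc = ≤-trans (m≤n⊔m (a ⊓ b) (b ⊓ c)) (m≤m⊔n _ (a ⊓ c))
  ac : a ⊓ c ≤ m
  ac = m≤n⊔m ((a ⊓ b) ⊔ (b ⊓ c)) (a ⊓ c)

module Hyperbolicity
  (G : Graph) (s s′ d M : ℕ) (s≡s′+d : s ≡ s′ + d) (0<d : 0 < d) (0<M : 0 < M)
  (2as′≤dM : 2 * ((s + s′) * s′) ≤ d * M) (dismantlable : Dismantlable G s s′)
  where

  open OctagonArea G s s′ d M s≡s′+d 0<d 2as′≤dM dismantlable using (collar-bound)

  -- In the sum of the two collar bounds the total segment length has coefficient 2 W on the left
  -- and 2 M on the right; with W = 2 M a coefficient of 2 M remains.
  W : ℕ
  W = M + M

  octagon-small : (O : Octagon G W) → let open Octagon O in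
                  len A₀ + len A₁ + len A₂ + len A₃ ≤ 40 * M
  octagon-small O = *-cancelˡ-≤ (2 * M) {{>-nonZero (<-≤-trans 0<M (m≤m+n M _))}}
    -- The chords give 16 W² = 64 M² and their share of the two perimeters 8 M W = 16 M², in total
    -- 80 M².
    (+-cancelʳ-≤ (2 * M * Σa) _ _ (begin
      2 * M * Σa + 2 * M * Σa
        ≡⟨ lem₁ a₀ a₁ a₂ a₃ M ⟩
      2 * (W * (a₀ + a₂)) + 2 * (W * (a₁ + a₃))
        ≤⟨ +-mono-≤ (collar-bound W O) (collar-bound W (rotate-octagon O)) ⟩
      (8 * (W * W) + M * (a₀ + a₁ + a₂ + a₃ + 4 * W)) + (8 * (W * W) + M * (a₁ + a₂ + a₃ + a₀ + 4 * W))
        ≡⟨ lem₂ a₀ a₁ a₂ a₃ M ⟩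
      2 * M * (40 * M) + 2 * M * Σa ∎))
    where
    open Octagon O
    open ≤-Reasoning
    a₀ = len A₀
    a₁ = len A₁
    a₂ = len A₂
    a₃ = len A₃
    Σa = a₀ + a₁ + a₂ + a₃
    lem₁ : ∀ a b c d M → 2 * M * (a + b + c + d) + 2 * M * (a + b + c + d) ≡
           2 * ((M + M) * (a + c)) + 2 * ((M + M) * (b + d))
    lem₁ = solve-∀
    lem₂ : ∀ a b c d M →
      (8 * ((M + M) * (M + M)) + M * (a + b + c + d + 4 * (M + M))) +
      (8 * ((M + M) * (M + M)) + M * (b + c + d + a + 4 * (M + M))) ≡
      2 * M * (40 * M) + 2 * M * (a + b + c + d)
    lem₂ = solve-∀

  -- The segments contribute 2 · 40 M and the corners 16 W = 32 M, so that 4 g ≤ 112 M.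
  no-fat-quadrilateral : ¬ Quadrilateral G (suc (28 * M))
  no-fat-quadrilateral Q = (
    cut W side₃ side₀ joint₃ >>= λ c₀ → cut W side₀ side₁ joint₀ >>= λ c₁ →
    cut W side₁ side₂ joint₁ >>= λ c₂ → cut W side₂ side₃ joint₂ >>= λ c₃ →
    λ k → k (impossible c₀ c₁ c₂ c₃)) λ ()
    where
    open Quadrilateral Q
    open ≤-Reasoning
    4W<g : 4 * W < suc (28 * M)
    4W<g = s≤s (≤-trans (≤-reflexive (lem M)) (*-monoˡ-≤ M {8} {28} (m≤m+n 8 20)))
      where
      lem : ∀ M → 4 * (M + M) ≡ 8 * M
      lem = solve-∀
    impossible : Cut W side₃ side₀ → Cut W side₀ side₁ → Cut W side₁ side₂ → Cut W side₂ side₃ → ⊥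
    impossible c₀ c₁ c₂ c₃ = 1+n≰n (*-cancelˡ-≤ 4 (begin
      4 * suc (28 * M)          ≤⟨ 4g≤ ⟩
      2 * (len A₀ + len A₁ + len A₂ + len A₃) + 16 * W
                                ≤⟨ +-monoˡ-≤ (16 * W) (*-monoʳ-≤ 2 (octagon-small octagon)) ⟩
      2 * (40 * M) + 16 * W     ≡⟨ lem M ⟩
      4 * (28 * M)              ∎))
      where
      open Truncation Q 4W<g c₀ c₁ c₂ c₃
      open Octagon octagon
      lem : ∀ M → 2 * (40 * M) + 16 * (M + M) ≡ 4 * (28 * M)
      lem = solve-∀

  diagonals≤sides : ∀ {u v x y duv dxy dux dvy duy dvx} →
    Dist G u v duv → Dist G x y dxy → Dist G u x dux → Dist G v y dvy → Dist G u y duy → Dist G v x dvx →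
    duv + dxy ≤ ((dux + dvy) ⊔ (duy + dvx)) + 28 * M
  diagonals≤sides {duv = duv} {dxy} uv xy ux vy uy vx
    with geodesic ux | geodesic (Dist-sym vx) | geodesic vy | geodesic (Dist-sym uy)
  ... | A₀ , refl , refl , refl | A₁ , refl , eq₁ , refl | A₂ , refl , eq₂ , refl | A₃ , refl , eq₃ , eq₄ =
    ≮⇒≥ λ sides<diagonals → no-fat-quadrilateral record
      { side₀ = A₀ ; side₁ = A₁ ; side₂ = A₂ ; side₃ = A₃
      ; joint₀ = sym eq₁ ; joint₁ = sym eq₂ ; joint₂ = sym eq₃ ; joint₃ = eq₄
      ; D₀ = duv ; D₁ = dxy
      ; diagonal₀ = λ {m} w → proj₂ uv m (subst (λ z → Walk G (source A₀) z m) eq₂ w)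
      ; diagonal₁ = λ {m} w → proj₂ xy m (subst₂ (λ z z′ → Walk G z z′ m) eq₁ eq₃ w)
      ; gap₀ = below sides<diagonals (m≤m⊔n (len A₀ + len A₂) _)
      ; gap₁ = below sides<diagonals
          (≤-trans (≤-reflexive (+-comm (len A₁) (len A₃))) (m≤n⊔m (len A₀ + len A₂) _))
      }
    where
    below : ∀ {i j k} → j + 28 * M < k → i ≤ j → i + suc (28 * M) ≤ k
    below {i} {j} j<k i≤j = ≤-trans (≤-reflexive (+-suc i _)) (≤-trans (s≤s (+-monoˡ-≤ _ i≤j)) j<k)

-- The constants.

⌈/⌉-lower : ∀ a d → 0 < d → a ≤ d * ⌈ a / d ⌉
⌈/⌉-lower a (suc k) _ = +-cancelˡ-≤ k _ _ (begin
  k + a                                   ≡⟨ +-comm k a ⟩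
  a + k                                   ≡⟨ m≡m%n+[m/n]*n (a + k) (suc k) ⟩
  (a + k) % suc k + (a + k) / suc k * suc k
    ≤⟨ +-mono-≤ (≤-pred (m%n<n (a + k) (suc k))) (≤-reflexive (*-comm ((a + k) / suc k) (suc k))) ⟩
  k + suc k * ((a + k) / suc k)           ∎)
  where open ≤-Reasoning

⌈/⌉-upper : ∀ a d → ⌈ a / d ⌉ * d ≤ a + d
⌈/⌉-upper a zero    = z≤n
⌈/⌉-upper a (suc k) = ≤-trans (m/n*n≤m (a + k) (suc k)) (+-monoʳ-≤ a (n≤1+n k))

module _ (s s′ d : ℕ) (s≡s′+d : s ≡ s′ + d) (0<s′ : 0 < s′) (0<d : 0 < d) where
  private
    a = s + s′
    k = ⌈ a / d ⌉

    s′+s′≤a : s′ + s′ ≤ a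
    s′+s′≤a = +-monoˡ-≤ s′ (≤-trans (m≤m+n s′ d) (≤-reflexive (sym s≡s′+d)))

    a≤dk : a ≤ d * k
    a≤dk = ⌈/⌉-lower a d 0<d

    0<a : 0 < a
    0<a = <-≤-trans 0<s′ (m≤n+m s′ s)

  0<ak : 0 < a * k
  0<ak = n≢0⇒n>0 λ ak≡0 → case m*n≡0⇒m≡0∨n≡0 a ak≡0 of λ
    { (inj₁ a≡0) → <⇒≢ 0<a (sym a≡0)
    ; (inj₂ k≡0) → <⇒≱ 0<a (≤-trans a≤dk (≤-reflexive (trans (cong (d *_) k≡0) (*-zeroʳ d)))) }

  -- This makes M = a k admissible: 2 s′ ≤ a ≤ d k.
  2as′≤d[ak] : 2 * (a * s′) ≤ d * (a * k)
  2as′≤d[ak] = begin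
    2 * (a * s′)    ≡⟨ lem a s′ ⟩
    a * (s′ + s′)   ≤⟨ *-monoʳ-≤ a (≤-trans s′+s′≤a a≤dk) ⟩
    a * (d * k)     ≡⟨ lem′ a d k ⟩
    d * (a * k)     ∎
    where
    open ≤-Reasoning
    lem : ∀ a t → 2 * (a * t) ≡ a * (t + t)
    lem = solve-∀
    lem′ : ∀ a d k → a * (d * k) ≡ d * (a * k)
    lem′ = solve-∀

  -- Rounding up adds at most `d` to `a`, and a + d = 2 s.
  δ-bound : 16 * a * k * d ≤ 32 * s * a
  δ-bound = begin
    16 * a * k * d    ≡⟨ *-assoc (16 * a) k d ⟩
    16 * a * (k * d)  ≤⟨ *-monoʳ-≤ (16 * a) (⌈/⌉-upper a d) ⟩
    16 * a * (a + d)  ≡⟨ cong (16 * a *_) (trans (+-assoc s s′ d) (cong (λ t → s + t) (sym s≡s′+d))) ⟩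
    16 * a * (s + s)  ≡⟨ lem a s ⟩
    32 * s * a        ∎
    where
    open ≤-Reasoning
    lem : ∀ a s → 16 * a * (s + s) ≡ 32 * s * a
    lem = solve-∀

theorem3 : (s s' : ℕ) → 0 < s' → s' < s → (G : Graph) → Connected G →
    Dismantlable G s s' →
    Hyperbolic2 G (32 * (s + s') * ⌈ (s + s') / (s ∸ s') ⌉ + 1)
    × (16 * (s + s') * ⌈ (s + s') / (s ∸ s') ⌉ * (s ∸ s') ≤ 32 * s * (s + s'))
theorem3 s s' 0<s' s'<s G _ dismantlable = hyperbolic , δ-bound s s' d s≡s'+d 0<s' 0<d
  where
  d = s ∸ s'
  M = (s + s') * ⌈ (s + s') / d ⌉
  0<d : 0 < d
  0<d = m<n⇒0<n∸m s'<s
  s≡s'+d : s ≡ s' + d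
  s≡s'+d = sym (m+[n∸m]≡n (<⇒≤ s'<s))

  open Hyperbolicity G s s' d M s≡s'+d 0<d (0<ak s s' d s≡s'+d 0<s' 0<d)
    (2as′≤d[ak] s s' d s≡s'+d 0<s' 0<d) dismantlable using (diagonals≤sides)

  28M≤2δ : 28 * M ≤ 32 * (s + s') * ⌈ (s + s') / d ⌉ + 1
  28M≤2δ = ≤-trans (*-monoˡ-≤ M {28} {32} (m≤m+n 28 4))
    (≤-trans (≤-reflexive (sym (*-assoc 32 (s + s') ⌈ (s + s') / d ⌉))) (m≤m+n _ 1))

  hyperbolic : Hyperbolic2 G (32 * (s + s') * ⌈ (s + s') / d ⌉ + 1)
  hyperbolic u v x y duv dxy dux dvy duy dvx uv xy ux vy uy vx =
    ≤-trans (largest≤middle (duv + dxy) (dux + dvy) (duy + dvx) (28 * M)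
      -- Each of the three sums in turn plays the part of the diagonals.
      (diagonals≤sides uv xy ux vy uy vx)
      (diagonals≤sides ux vy uv xy uy (Dist-sym vx))
      (diagonals≤sides uy vx uv (Dist-sym xy) ux (Dist-sym vy)))
    (+-monoʳ-≤ (((duv + dxy) ⊓ (dux + dvy)) ⊔ ((dux + dvy) ⊓ (duy + dvx)) ⊔ ((duv + dxy) ⊓ (duy + dvx)))
      28M≤2δ)
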